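{- Let $k,n$ be positive integers with $2k<n$, let $q$ be a prime power with $q\ge nk$, let $\gamma$ be a primitive element of $\mathbb{F}_q$, and let $\mathcal{F}_{n,k}=\{S_1,\dots,S_m\}$, $m=q^{n-2k}$, be the family of subspaces of $\mathbb{F}_q^n$ constructed in the context. Then $\mathcal{F}_{n,k}$ is a partial spread of $k$-dimensional subspaces in $\mathbb{F}_q^n$. Moreover, for $k=1$ and $k=2$, the family $\mathcal{F}_{n,k}$ is $[n,k,L_{n,k}]_q$-AAD with $L_{n,1}=n-1$ and $L_{n,2}=1+2(n-2)(2n-5)$.
   Context: A partial spread of $k$-dimensional subspaces (partial $k$-spread) in $\mathbb{F}_q^n$ is a collection of $k$-dimensional linear subspaces with pairwise trivial intersection (i.e. equal to $\{0\}$). For $u\in\mathbb{F}_q^n$ and a subspace $S$, $u+S=\{u+v: v\in S\}$. For positive integers $k,n$ with $2k<n$, a family $\mathcal{F}$ of $k$-dimensional linear subspaces of $\mathbb{F}_q^n$ is $L$-almost affinely disjoint, written $[n,k,L]_q$-AAD, if (1) $\mathcal{F}$ is a partial $k$-spread of $\mathbb{F}_q^n$, and (2) for every $S\in\mathcal{F}$ and every $u\in\mathbb{F}_q^n\setminus S$, the affine subspace $u+S$ intersects (has nonempty intersection with) at most $L$ subspaces from $\mathcal{F}$. Construction of $\mathcal{F}_{n,k}$. Let $q\ge nk$, $m=q^{n-2k}$, and $\gamma$ a primitive element of $\mathbb{F}_q$. Let $\mathcal{C}\subseteq\mathbb{F}_q^{n-k-1}$ be the $[n-k-1,n-2k,k]_q$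 Reed–Solomon code (length $n-k-1$, dimension $n-2k$, minimum distance $k$) with the $(k-1)\times(n-k-1)$ parity-check matrix whose entry in row $t\in\{1,\dots,k-1\}$ and column $p\in\{1,\dots,n-k-1\}$ is $\gamma^{(p-1)(t-1)}$, that is, $\mathcal{C}=\{x\in\mathbb{F}_q^{n-k-1}:\sum_{p=1}^{n-k-1}\gamma^{(p-1)(t-1)}x_p=0 \text{ for all } t=1,\dots,k-1\}$ (for $k=1$, there is no constraint and $\mathcal{C}=\mathbb{F}_q^{n-2}$). Let $c_1,\dots,c_m$ be the $m=q^{n-2k}$ distinct codewords of $\mathcal{C}$. For $j\in\{1,\dots,k\}$ define $\Gamma_j:\mathbb{F}_q^{n-k-1}\to\mathbb{F}_q^{n-k-1}$ and $h_j:\mathbb{F}_q^{n-k-1}\to\mathbb{F}_q$ by $$\Gamma_j(x)=\big(\gamma^{j-1}x_1,\ \gamma^{2(j-1)}x_2,\ \dots,\ \gamma^{(n-k-1)(j-1)}x_{n-k-1}\big),\qquad h_j(x)=\sum_{p=1}^{n-k-1}x_p^{(j-1)(n-k-1)+p+1}.$$ For $i\in\{1,\dots,m\}$ and $j\in\{1,\dots,k\}$ let $v_{i,j}=(e_j,\ \Gamma_j(c_i),\ h_j(c_i))\in\mathbb{F}_q^{n}$ (concatenation), where $e_j$ is the unit vector of length $k$ with a one in position $j$. Let $S_i$ be the span of $v_{i,1},\dots,v_{i,k}$, and $\mathcal{F}_{n,k}=\{S_1,\dots,S_m\}$. -}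

module Defs where

open import Algebra.Bundles using (CommutativeRing)
import Algebra.Definitions as AlgebraDefinitions
import Algebra.Properties.Semiring.Exp as Exp
import Algebra.Properties.Semiring.Sum as Sum
open import Data.Bool.Base using (if_then_else_)
open import Data.Fin.Base as Fin using (Fin; toℕ)
open import Data.Fin.Properties using (_≟_)
open import Data.Fin.Subset using (Subset; ∣_∣) renaming (_∈_ to _∈ˢ_)
open import Data.Nat.Base as ℕ using (ℕ; suc; _∸_; _≤_; _<_)
import Data.Nat.Properties as ℕₚ
open import Data.Nat.Primality using (Prime)
open import Data.Product.Base using (Σ; ∃; ∃₂; _×_; _,_; proj₁)
open import Data.Vec.Functional using (Vector; zipWith; map; replicate; _++_)
import Data.Vec.Functional.Relation.Binary.Equality.Setoid as VectorEquality
open import Function.Bundles using (Inverse; Bijection)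
open import Level using (Level; _⊔_) renaming (suc to lsuc)
open import Relation.Binary.Bundles using (Setoid)
import Relation.Binary.Construct.On as On
open import Relation.Binary.PropositionalEquality as ≡ using (_≡_; _≢_)
open import Relation.Nullary using (¬_; does)
open import Relation.Unary using (Pred; _∈_; _∉_; _≐_; _≬_)

IsPrimePower : ℕ → Set
IsPrimePower q = ∃₂ λ p r → Prime p × q ≡ p ℕ.^ suc r

record FiniteField (c ℓ : Level) (q : ℕ) : Set (lsuc (c ⊔ ℓ)) where
  field
    commutativeRing : CommutativeRing c ℓ

  open CommutativeRing commutativeRing public
  open AlgebraDefinitions _≈_ using (Invertible)

  field
    1≉0        : ¬ (1# ≈ 0#)
    invertible : ∀ x → ¬ (x ≈ 0#) → Invertible 1# _*_ x
    finite     : Inverse setoid (≡.setoid (Fin q))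

module _ {c ℓ : Level} {q : ℕ} (F : FiniteField c ℓ q) where

  open FiniteField F
  open Exp semiring using (_^_)
  open Sum semiring using (sum; ∑-distrib-+; *-distribˡ-sum; sum-cong-≋; sum-replicate-zero)
  open VectorEquality setoid using (_≋_; ≋-setoid)

  IsPrimitive : Carrier → Set (c ⊔ ℓ)
  IsPrimitive γ = ¬ (γ ≈ 0#) × (∀ x → ¬ (x ≈ 0#) → ∃ λ e → x ≈ γ ^ e)

  0ᵛ : ∀ {n} → Vector Carrier n
  0ᵛ {n} = replicate n 0#

  infixl 6 _+ᵛ_
  _+ᵛ_ : ∀ {n} → Vector Carrier n → Vector Carrier n → Vector Carrier n
  _+ᵛ_ = zipWith _+_

  infixr 7 _*ᵛ_
  _*ᵛ_ : ∀ {n} → Carrier → Vector Carrier n → Vector Carrier n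
  a *ᵛ v = map (a *_) v

  record Subspace (n : ℕ) : Set (lsuc (c ⊔ ℓ)) where
    field
      ∣S∣      : Pred (Vector Carrier n) (c ⊔ ℓ)
      resp-≋   : ∀ {u v} → u ≋ v → u ∈ ∣S∣ → v ∈ ∣S∣
      0-closed : 0ᵛ ∈ ∣S∣
      +-closed : ∀ {u v} → u ∈ ∣S∣ → v ∈ ∣S∣ → u +ᵛ v ∈ ∣S∣
      *-closed : ∀ a {v} → v ∈ ∣S∣ → a *ᵛ v ∈ ∣S∣

  open Subspace using (∣S∣)

  linearCombination : ∀ {n k} → Vector Carrier k → Vector (Vector Carrier n) k → Vector Carrier n
  linearCombination a v p = sum (λ i → a i * v i p)

  span : ∀ {n k} → Vector (Vector Carrier n) k → Subspace n
  span {n} {k} v = record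
    { ∣S∣      = λ u → ∃ λ (a : Vector Carrier k) → u ≋ linearCombination a v
    ; resp-≋   = λ { u≋w (a , eq) → a , λ p → trans (sym (u≋w p)) (eq p) }
    ; 0-closed = 0ᵛ , λ p →
        trans (sym (sum-replicate-zero k)) (sum-cong-≋ {k} (λ i → sym (zeroˡ (v i p))))
    ; +-closed = λ { (a , eq) (b , eq′) → a +ᵛ b , λ p →
        trans (+-cong (eq p) (eq′ p))
        (trans (sym (∑-distrib-+ (λ i → a i * v i p) (λ i → b i * v i p)))
               (sum-cong-≋ {k} (λ i → sym (distribʳ (v i p) (a i) (b i))))) }
    ; *-closed = λ { x (a , eq) → x *ᵛ a , λ p →
        trans (*-congˡ (eq p))
        (trans (*-distribˡ-sum x (λ i → a i * v i p))
               (sum-cong-≋ {k} (λ i → sym (*-assoc x (a i) (v i p))))) }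
    }

  LinearlyIndependent : ∀ {n k} → Vector (Vector Carrier n) k → Set (c ⊔ ℓ)
  LinearlyIndependent v = ∀ a → linearCombination a v ≋ 0ᵛ → a ≋ 0ᵛ

  HasDimension : ∀ {n} → ℕ → Subspace n → Set (c ⊔ ℓ)
  HasDimension {n} k S = Σ (Vector (Vector Carrier n) k) λ b →
    LinearlyIndependent b × ∣S∣ (span b) ≐ ∣S∣ S

  -- The affine subspace u + S.
  translate : ∀ {n} → Vector Carrier n → Subspace n → Pred (Vector Carrier n) (c ⊔ ℓ)
  translate u S x = ∃ λ v → v ∈ ∣S∣ S × x ≋ u +ᵛ v

  -- Trivial intersection is demanded for distinct indices, so for k > 0 the
  -- members of a partial k-spread are automatically distinct subspaces.
  record IsPartialSpread (n k : ℕ) {m : ℕ} (𝓕 : Vector (Subspace n) m) : Set (c ⊔ ℓ) where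
    field
      dimension           : ∀ i → HasDimension k (𝓕 i)
      trivialIntersection : ∀ {i j} → i ≢ j → ∀ v → v ∈ ∣S∣ (𝓕 i) → v ∈ ∣S∣ (𝓕 j) → v ≋ 0ᵛ

  -- "At most L members meet u + S": every set J of indices of members that
  -- meet u + S has at most L elements.
  record IsAAD (n k L : ℕ) {m : ℕ} (𝓕 : Vector (Subspace n) m) : Set (c ⊔ ℓ) where
    field
      isPartialSpread : IsPartialSpread n k 𝓕
      atMost          : ∀ i u → u ∉ ∣S∣ (𝓕 i) →
                        ∀ (J : Subset m) →
                        (∀ {j} → j ∈ˢ J → translate u (𝓕 i) ≬ ∣S∣ (𝓕 j)) →
                        ∣ J ∣ ≤ L

  -- Indices start at 0 here, so j : Fin k stands for the index toℕ j + 1 of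
  -- the usual 1-based formulas, and likewise for t and p.

  module _ (n k : ℕ) (γ : Carrier) where

    codeLength : ℕ
    codeLength = n ∸ k ∸ 1

    parityCheck : Fin (k ∸ 1) → Fin codeLength → Carrier
    parityCheck t p = γ ^ (toℕ p ℕ.* toℕ t)

    IsCodeword : Pred (Vector Carrier codeLength) ℓ
    IsCodeword x = ∀ t → sum (λ p → parityCheck t p * x p) ≈ 0#

    codeSetoid : Setoid (c ⊔ ℓ) ℓ
    codeSetoid = On.setoid {B = ∃ IsCodeword} (≋-setoid codeLength) proj₁

    CodewordEnumeration : Set (c ⊔ ℓ)
    CodewordEnumeration = Bijection (≡.setoid (Fin (q ℕ.^ (n ∸ 2 ℕ.* k)))) codeSetoid

    Γ : Fin k → Vector Carrier codeLength → Vector Carrier codeLength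
    Γ j x p = γ ^ (suc (toℕ p) ℕ.* toℕ j) * x p

    h : Fin k → Vector Carrier codeLength → Carrier
    h j x = sum (λ p → x p ^ (toℕ j ℕ.* codeLength ℕ.+ toℕ p ℕ.+ 2))

    e : Fin k → Vector Carrier k
    e j i = if does (i ≟ j) then 1# else 0#

    length-≡ : 2 ℕ.* k < n → k ℕ.+ (codeLength ℕ.+ 1) ≡ n
    length-≡ 2k<n = ≡.trans
      (≡.cong (k ℕ.+_) (ℕₚ.m∸n+n≡m (ℕₚ.m<n⇒0<n∸m k<n)))
      (ℕₚ.m+[n∸m]≡n (ℕₚ.<⇒≤ k<n))
      where
      k<n : k < n
      k<n = ℕₚ.≤-<-trans (ℕₚ.m≤m+n k (k ℕ.+ 0)) 2k<n

    module _ (2k<n : 2 ℕ.* k < n) where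

      generator : Vector Carrier codeLength → Fin k → Vector Carrier n
      generator x j p =
        (e j ++ (Γ j x ++ replicate 1 (h j x))) (Fin.cast (≡.sym (length-≡ 2k<n)) p)

      family : CodewordEnumeration → Vector (Subspace n) (q ℕ.^ (n ∸ 2 ℕ.* k))
      family enum i = span (generator (proj₁ (Bijection.to enum i)))

{-# OPTIONS --safe #-}

-- Write A a p = ∑ a j · γ ^ ((p + 1) j). A nonzero word orthogonal to all
-- polynomials of degree < k - 1 in the nodes γ ^ p cannot vanish wherever a
-- nonzero polynomial f of degree < k does not: dividing f by the linear factor of
-- a support point gives a quotient that still vanishes on the support. Applied
-- to A a this shows that the members meet trivially.
--
-- Normalise u to (0 , w , w∞). Then u + S meets the member with codeword x′ iff,
-- for some a, w p = A a p · (x′ - x) p and w∞ = ∑ a j · (h j x′ - h j x). For a on a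
-- fixed line through 0, all codewords x′ lie on one affine line x + s D, and the
-- second equation is a nonzero polynomial equation of degree ≤ k N + 1 in s, because
-- the exponents in the h j are distinct and at least 2. This settles k = 1.
-- For k = 2, ∑ (x′ - x) p = 0 makes the slope a 0 / a 1 a root of the numerator of
-- ∑ w p / (γ ^ (p + 1) + slope), which has degree ≤ N, so with the infinite slope
-- there are at most N + 1 lines.
module Submission where

open import Defs
import Algebra.Properties.Group as GroupProperties
import Algebra.Properties.Ring as RingProperties
import Algebra.Properties.Semiring.Exp as Exp
import Algebra.Properties.Semiring.Sum as Sum
import Algebra.Solver.Ring.NaturalCoefficients.Default as RingSolver
open import Data.Fin.Base as Fin using (Fin; zero; suc; toℕ)
open import Data.Fin.Properties as Finₚ using (_≟_)
open import Data.Fin.Subset using (Subset; ∣_∣; _⊆_; inside; outside; ⁅_⁆)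
  renaming (_∈_ to _∈ˢ_)
open import Data.Fin.Subset.Properties using (_∈?_; nonempty?; p⊆q⇒∣p∣≤∣q∣; ∣⁅x⁆∣≡1; x∈⁅x⁆; ∣⊥∣≡0;
  Empty-unique)
open import Data.Nat as ℕ using (ℕ; zero; suc; _+_; _*_; _∸_; _≤_; _<_; z≤n; s≤s; s≤s⁻¹)
open import Data.Nat.DivMod using (_/_; _mod_; _divMod_; DivMod)
import Data.Nat.Properties as ℕₚ
open import Data.Nat.Tactic.RingSolver using (solve-∀)
open import Data.Product using (_×_; _,_; proj₁; proj₂; ∃; ∃₂)
open import Data.Sum using (_⊎_; inj₁; inj₂)
open import Data.Vec.Base using (_∷_; []; here; there)
open import Data.Vec.Functional using (Vector; head; tail; replicate; _++_)
open import Data.Vec.Functional.Properties using (lookup-++ˡ; lookup-++ʳ)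
import Data.Vec.Functional.Relation.Binary.Equality.Setoid as VectorEquality
open import Function.Base using (_∘_)
open import Function.Bundles using (Inverse; Bijection)
open import Function.Properties.Inverse using (Inverse⇒Injection)
open import Level using (Level; _⊔_)
open import Relation.Binary.Definitions using (Decidable; tri<; tri≈; tri>)
open import Relation.Binary.PropositionalEquality as ≡ using (_≡_; _≢_)
import Relation.Binary.Reasoning.Setoid as SetoidReasoning
open import Relation.Nullary using (¬_; yes; no; contradiction)
open import Relation.Nullary.Decidable using (via-injection)
open import Relation.Unary as Unary using (Pred)

-- Cardinalities of finite subsets and arithmetic of the bounds.

module Counting where

  split : ∀ {m p} {P : Pred (Fin m) p} → Unary.Decidable P → (J : Subset m) →
          ∃₂ λ J₁ J₂ → ∣ J ∣ ≡ ∣ J₁ ∣ + ∣ J₂ ∣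
            × (∀ {j} → j ∈ˢ J₁ → j ∈ˢ J × P j) × (∀ {j} → j ∈ˢ J₂ → j ∈ˢ J × ¬ P j)
  split P? [] = [] , [] , ≡.refl , (λ ()) , (λ ())
  split P? (outside ∷ J) with split (P? ∘ suc) J
  ... | J₁ , J₂ , eq , f , g = outside ∷ J₁ , outside ∷ J₂ , eq
    , (λ { (there x) → there (proj₁ (f x)) , proj₂ (f x) })
    , (λ { (there x) → there (proj₁ (g x)) , proj₂ (g x) })
  split P? (inside ∷ J) with split (P? ∘ suc) J | P? zero
  ... | J₁ , J₂ , eq , f , g | yes p = inside ∷ J₁ , outside ∷ J₂ , ≡.cong suc eq
    , (λ { here → here , p ; (there x) → there (proj₁ (f x)) , proj₂ (f x) })
    , (λ { (there x) → there (proj₁ (g x)) , proj₂ (g x) })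
  ... | J₁ , J₂ , eq , f , g | no ¬p = outside ∷ J₁ , inside ∷ J₂ ,
    ≡.trans (≡.cong suc eq) (≡.sym (ℕₚ.+-suc ∣ J₁ ∣ ∣ J₂ ∣))
    , (λ { (there x) → there (proj₁ (f x)) , proj₂ (f x) })
    , (λ { here → here , ¬p ; (there x) → there (proj₁ (g x)) , proj₂ (g x) })

  ∣J∣≤0 : ∀ {m} {J : Subset m} → (∀ {j} → ¬ (j ∈ˢ J)) → ∣ J ∣ ≤ 0
  ∣J∣≤0 {m} {J} empty = ℕₚ.≤-reflexive
    (≡.trans (≡.cong ∣_∣ (Empty-unique {p = J} λ { (_ , j∈J) → empty j∈J })) (∣⊥∣≡0 m))

  ∣J∣≤1 : ∀ {m} {J : Subset m} → (∀ {i j} → i ∈ˢ J → j ∈ˢ J → i ≡ j) → ∣ J ∣ ≤ 1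
  ∣J∣≤1 {J = J} unique with nonempty? J
  ... | yes (i , i∈J) = ℕₚ.≤-trans
    (p⊆q⇒∣p∣≤∣q∣ λ j∈J → ≡.subst (_∈ˢ ⁅ i ⁆) (unique i∈J j∈J) (x∈⁅x⁆ i))
    (ℕₚ.≤-reflexive (∣⁅x⁆∣≡1 i))
  ... | no empty = ℕₚ.≤-trans (∣J∣≤0 λ j∈J → empty (_ , j∈J)) z≤n

  -- Turns witnesses available only on `J` into one total function of the index, which root counting
  -- requires; the default fills the indices outside `J`, where nothing is claimed.
  chooseOn : ∀ {m a r} {A : Set a} {R : Fin m → A → Set r} → A → (J : Subset m) →
             (∀ {j} → j ∈ˢ J → ∃ (R j)) → ∃ λ (σ : Fin m → A) → ∀ {j} → j ∈ˢ J → R j (σ j)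
  chooseOn {A = A} {R} default J choose = proj₁ ∘ σ , λ {j} → proj₂ (σ j)
    where
    σ : ∀ j → ∃ λ a → j ∈ˢ J → R j a
    σ j with j ∈? J
    ... | yes j∈J = proj₁ (choose j∈J) , λ _ → proj₂ (choose j∈J)
    ... | no  j∉J = default , λ j∈J → contradiction j∈J j∉J

  -- The extreme case is the last index in both ranges: `(k - 1) N + (N - 1) + 2 = k N + 1`.
  degree-bound : ∀ {k N} (j : Fin k) (t : Fin N) → toℕ j * N + toℕ t + 2 ≤ k * N + 1
  degree-bound {suc k} {N} j t = begin
    toℕ j * N + toℕ t + 2          ≡⟨ ℕₚ.+-suc (toℕ j * N + toℕ t) 1 ⟩
    suc (toℕ j * N + toℕ t) + 1    ≡⟨ ≡.cong (_+ 1) (ℕₚ.+-suc (toℕ j * N) (toℕ t)) ⟨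
    toℕ j * N + suc (toℕ t) + 1
      ≤⟨ ℕₚ.+-monoˡ-≤ 1 (ℕₚ.+-mono-≤ (ℕₚ.*-monoˡ-≤ N (s≤s⁻¹ (Finₚ.toℕ<n j))) (Finₚ.toℕ<n t)) ⟩
    k * N + N + 1                  ≡⟨ ≡.cong (_+ 1) (ℕₚ.+-comm (k * N) N) ⟩
    suc k * N + 1                  ∎
    where open ℕₚ.≤-Reasoning

  -- Here `N = n - 3` and `K = 2 n - 5`, so the left side is `(n - 2) (2 n - 5)`; doubling the first
  -- factor and adding 1 gives the right side.
  slope-bound : ∀ {n} → 4 < n → let N = n ∸ 2 ∸ 1; K = 2 * N + 1 in
                K + N * K ≤ 1 + 2 * (n ∸ 2) * (2 * n ∸ 5)
  slope-bound {n} 4<n with ℕₚ.m≤n⇒∃[o]m+o≡n 4<n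
  ... | o , ≡.refl = ℕₚ.m≤n⇒m≤1+n (ℕₚ.*-mono-≤ (ℕₚ.m≤m+n (3 + o) (3 + o + 0)) (ℕₚ.≤-reflexive (K≡ o)))
    where
    K≡ : ∀ o → 2 * (2 + o) + 1 ≡ o + (5 + (o + 0))
    K≡ = solve-∀

open Counting

-- Field arithmetic and finite sums.

module Field {c ℓ : Level} {q : ℕ} (F : FiniteField c ℓ q) where

  open FiniteField F hiding (zero) renaming (_+_ to _⊕_; _*_ to _·_)
  open Exp semiring
  open Sum semiring
  open RingProperties ring using ([y-z]x≈yx-zx; -‿distribʳ-*; -‿+-comm; -1*x≈-x)
  open GroupProperties +-group using (x∙y⁻¹≈ε⇒x≈y; x≈y⇒x∙y⁻¹≈ε; ∙-cancelʳ)
  open SetoidReasoning setoid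
  open RingSolver commutativeSemiring using (solve; _:=_; _:+_; _:*_)

  _≈?_ : Decidable _≈_
  _≈?_ = via-injection (Inverse⇒Injection finite) _≟_

  inverse : ∀ {x} → ¬ x ≈ 0# → ∃ λ y → y · x ≈ 1#
  inverse {x} x≉0 = let y , y·x≈1 , _ = invertible x x≉0 in y , y·x≈1

  ·-cancelˡ : ∀ {x y z} → ¬ x ≈ 0# → x · y ≈ x · z → y ≈ z
  ·-cancelˡ {x} {y} {z} x≉0 eq = begin
    y              ≈⟨ expand y ⟩
    x⁻¹ · (x · y)  ≈⟨ *-congˡ eq ⟩
    x⁻¹ · (x · z)  ≈⟨ expand z ⟨
    z              ∎
    where
    x⁻¹ = proj₁ (inverse x≉0)
    expand : ∀ y → y ≈ x⁻¹ · (x · y)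
    expand y = begin
      y              ≈⟨ *-identityˡ y ⟨
      1# · y         ≈⟨ *-congʳ (proj₂ (inverse x≉0)) ⟨
      x⁻¹ · x · y    ≈⟨ *-assoc x⁻¹ x y ⟩
      x⁻¹ · (x · y)  ∎

  x·y≈0⇒y≈0 : ∀ {x y} → ¬ x ≈ 0# → x · y ≈ 0# → y ≈ 0#
  x·y≈0⇒y≈0 {x} x≉0 eq = ·-cancelˡ x≉0 (trans eq (sym (zeroʳ x)))

  x·y≉0 : ∀ {x y} → ¬ x ≈ 0# → ¬ y ≈ 0# → ¬ x · y ≈ 0#
  x·y≉0 x≉0 y≉0 eq = y≉0 (x·y≈0⇒y≈0 x≉0 eq)

  x^n≉0 : ∀ {x} → ¬ x ≈ 0# → ∀ n → ¬ x ^ n ≈ 0#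
  x^n≉0 x≉0 zero    = 1≉0
  x^n≉0 x≉0 (suc n) = x·y≉0 x≉0 (x^n≉0 x≉0 n)

  x·z≈y·z⇒z≈0 : ∀ {x y z} → ¬ x ≈ y → x · z ≈ y · z → z ≈ 0#
  x·z≈y·z⇒z≈0 {x} {y} {z} x≉y eq = x·y≈0⇒y≈0 {x - y} (x≉y ∘ x∙y⁻¹≈ε⇒x≈y x y)
    (trans ([y-z]x≈yx-zx z x y) (x≈y⇒x∙y⁻¹≈ε eq))

  difference : ∀ x y → 1# · x ⊕ (- 1#) · y ≈ x - y
  difference x y = +-cong (*-identityˡ x) (-1*x≈-x y)

  x⊕y≈y⇒x≈0 : ∀ {x y z} → x ⊕ y ≈ z → y ≈ z → x ≈ 0#
  x⊕y≈y⇒x≈0 {x} {y} eq y≈z = ∙-cancelʳ y x 0# (trans eq (trans (sym y≈z) (sym (+-identityˡ y))))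

  sum-zero : ∀ {n} {f : Vector Carrier n} → (∀ i → f i ≈ 0#) → sum f ≈ 0#
  sum-zero {n} f≈0 = trans (sum-cong-≋ f≈0) (sum-replicate-zero n)

  sum-single : ∀ {n} (f : Vector Carrier n) t → (∀ i → i ≢ t → f i ≈ 0#) → sum f ≈ f t
  sum-single f zero    f≈0 = trans (+-congˡ (sum-zero λ i → f≈0 (suc i) λ ())) (+-identityʳ _)
  sum-single f (suc t) f≈0 = trans
    (+-cong (f≈0 zero λ ()) (sum-single (tail f) t λ i i≢t → f≈0 (suc i) (i≢t ∘ Finₚ.suc-injective)))
    (+-identityˡ _)

  -- Locates leading terms: exponents grow with the index below, so the last nonzero entry
  -- determines a degree.
  lastNonzero : ∀ {n} (v : Vector Carrier n) →
    (∃ λ t → ¬ v t ≈ 0# × (∀ i → t Fin.< i → v i ≈ 0#)) ⊎ (∀ i → v i ≈ 0#)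
  lastNonzero {zero}  v = inj₂ λ ()
  lastNonzero {suc n} v with lastNonzero (tail v)
  ... | inj₁ (t , v≉0 , rest) = inj₁ (suc t , v≉0 , λ { (suc i) t<i → rest i (s≤s⁻¹ t<i) })
  ... | inj₂ rest with v zero ≈? 0#
  ...   | yes v₀≈0 = inj₂ λ { zero → v₀≈0 ; (suc i) → rest i }
  ...   | no  v₀≉0 = inj₁ (zero , v₀≉0 , λ { (suc i) _ → rest i })

  -- Polynomial functions with a degree bound and a leading coefficient.

  -- Polynomial d a f: f is a polynomial function of degree at most d, given by
  -- a Horner scheme in which a is the (possibly zero) coefficient of x ^ d.
  data Polynomial : ℕ → Carrier → (Carrier → Carrier) → Set (c ⊔ ℓ) where
    constant : ∀ {a f} → (∀ x → f x ≈ a) → Polynomial 0 a f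
    horner   : ∀ {d a f g b} → Polynomial d a g → (∀ x → f x ≈ x · g x ⊕ b) → Polynomial (suc d) a f

  polynomial-resp : ∀ {d a a′ f f′} → a ≈ a′ → (∀ x → f x ≈ f′ x) → Polynomial d a f → Polynomial d a′ f′
  polynomial-resp a≈a′ f≈f′ (constant eq) = constant λ x → trans (sym (f≈f′ x)) (trans (eq x) a≈a′)
  polynomial-resp a≈a′ f≈f′ (horner g eq) =
    horner (polynomial-resp a≈a′ (λ _ → refl) g) λ x → trans (sym (f≈f′ x)) (eq x)

  polynomial-+ : ∀ {d a b f g} → Polynomial d a f → Polynomial d b g → Polynomial d (a ⊕ b) λ x → f x ⊕ g x
  polynomial-+ (constant eq) (constant eq′) = constant λ x → +-cong (eq x) (eq′ x)
  polynomial-+ (horner {g = g} {b} p eq) (horner {g = g′} {b′} p′ eq′) = horner (polynomial-+ p p′) λ x →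
    trans (+-cong (eq x) (eq′ x))
      (solve 5 (λ x g b g′ b′ → (x :* g :+ b) :+ (x :* g′ :+ b′) := x :* (g :+ g′) :+ (b :+ b′)) refl
        x (g x) b (g′ x) b′)

  polynomial-· : ∀ {d a f} r → Polynomial d a f → Polynomial d (r · a) λ x → r · f x
  polynomial-· r (constant eq) = constant λ x → *-congˡ (eq x)
  polynomial-· r (horner {g = g} {b} p eq) = horner (polynomial-· r p) λ x →
    trans (*-congˡ (eq x))
      (solve 4 (λ r x g b → r :* (x :* g :+ b) := x :* (r :* g) :+ r :* b) refl r x (g x) b)

  polynomial-suc : ∀ {d a f} → Polynomial d a f → Polynomial (suc d) 0# f
  polynomial-suc {a = a} (constant eq) = horner (constant λ _ → refl) λ x →
    trans (eq x) (sym (trans (+-congʳ (zeroʳ x)) (+-identityˡ a)))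
  polynomial-suc (horner p eq) = horner (polynomial-suc p) eq

  polynomial-zero : ∀ {d f} → (∀ x → f x ≈ 0#) → Polynomial d 0# f
  polynomial-zero {zero}  f≈0 = constant f≈0
  polynomial-zero {suc d} f≈0 = polynomial-suc (polynomial-zero f≈0)

  polynomial-raise : ∀ {d e a f} → d < e → Polynomial d a f → Polynomial e 0# f
  polynomial-raise {d} {suc e} d<e p with ℕₚ.m≤n⇒m<n∨m≡n (s≤s⁻¹ d<e)
  ... | inj₁ d<e′   = polynomial-suc (polynomial-raise d<e′ p)
  ... | inj₂ ≡.refl = polynomial-suc p

  polynomial-lower : ∀ {d f} → Polynomial (suc d) 0# f → ∃ λ a → Polynomial d a f
  polynomial-lower (horner {b = b} (constant eq) eq′) = b , constant λ x →
    trans (eq′ x) (trans (+-congʳ (trans (*-congˡ (eq x)) (zeroʳ x))) (+-identityˡ b))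
  polynomial-lower (horner p@(horner _ _) eq) = let a , p′ = polynomial-lower p in a , horner p′ eq

  polynomial-linear : ∀ {d a f} y z → Polynomial d a f → Polynomial (suc d) (z · a) λ x → (y ⊕ x · z) · f x
  polynomial-linear {f = f} y z p = polynomial-resp (trans (+-congʳ (zeroʳ y)) (+-identityˡ _))
    (λ x → solve 4 (λ y z x f → y :* f :+ z :* (x :* f) := (y :+ x :* z) :* f) refl y z x (f x))
    (polynomial-+ (polynomial-· y (polynomial-suc p))
                  (polynomial-· z (horner p λ x → sym (+-identityʳ (x · f x)))))

  polynomial-power : ∀ y z n → Polynomial n (z ^ n) λ x → (y ⊕ x · z) ^ n
  polynomial-power y z zero    = constant λ _ → refl
  polynomial-power y z (suc n) = polynomial-linear y z (polynomial-power y z n)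

  polynomial-sum-zero : ∀ {n d} {f : Fin n → Carrier → Carrier} → (∀ i → Polynomial d 0# (f i)) →
                        Polynomial d 0# λ x → sum λ i → f i x
  polynomial-sum-zero {zero}  p = polynomial-zero λ _ → refl
  polynomial-sum-zero {suc n} p =
    polynomial-resp (+-identityˡ 0#) (λ _ → refl) (polynomial-+ (p zero) (polynomial-sum-zero (p ∘ suc)))

  polynomial-sum : ∀ {n d a} {f : Fin n → Carrier → Carrier} t → Polynomial d a (f t) →
                   (∀ i → i ≢ t → Polynomial d 0# (f i)) → Polynomial d a λ x → sum λ i → f i x
  polynomial-sum zero p p₀ =
    polynomial-resp (+-identityʳ _) (λ _ → refl) (polynomial-+ p (polynomial-sum-zero λ i → p₀ (suc i) λ ()))
  polynomial-sum (suc t) p p₀ = polynomial-resp (+-identityˡ _) (λ _ → refl) (polynomial-+ (p₀ zero λ ())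
    (polynomial-sum t p λ i i≢t → p₀ (suc i) (i≢t ∘ Finₚ.suc-injective)))

  -- Terms before `t` have smaller degree and terms after `t` have coefficient zero at `x ^ e t`, so
  -- the leading coefficient of term `t` survives in the sum.
  polynomial-sum-dominant : ∀ {n} {e : Fin n → ℕ} {b : Vector Carrier n} {f : Fin n → Carrier → Carrier} t →
    (∀ i → i Fin.< t → e i < e t) → (∀ i → Polynomial (e i) (b i) (f i)) →
    (∀ i → t Fin.< i → Polynomial (e t) 0# (f i)) → Polynomial (e t) (b t) λ x → sum λ i → f i x
  polynomial-sum-dominant {e = e} {f = f} t e<e p p₀ = polynomial-sum t (p t) others
    where
    others : ∀ i → i ≢ t → Polynomial (e t) 0# (f i)
    others i i≢t with Finₚ.<-cmp i t
    ... | tri< i<t _ _ = polynomial-raise (e<e i i<t) (p i)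
    ... | tri≈ _ i≡t _ = contradiction i≡t i≢t
    ... | tri> _ _ t<i = p₀ i t<i

  -- Division by a linear factor and counting of roots.

  -- f x - f r = (x - r) · g x, with both sides moved so that no subtraction occurs.
  divide : ∀ {d a f} r → Polynomial (suc d) a f →
           ∃ λ g → Polynomial d a g × (∀ x → f x ⊕ r · g x ≈ x · g x ⊕ f r)
  divide {f = f} r (horner {g = g} {b} p@(constant eq) eq′) = g , p , λ x → begin
    f x ⊕ r · g x              ≈⟨ +-cong (eq′ x) (*-congˡ (trans (eq x) (sym (eq r)))) ⟩
    x · g x ⊕ b ⊕ r · g r      ≈⟨ solve 3 (λ u v b → (u :+ b) :+ v := u :+ (v :+ b)) refl (x · g x) (r · g r) b ⟩
    x · g x ⊕ (r · g r ⊕ b)    ≈⟨ +-congˡ (eq′ r) ⟨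
    x · g x ⊕ f r              ∎
  divide {f = f} r (horner {g = g} {b} p@(horner _ _) eq′) with divide r p
  -- The difference x g(x) - r g(r) equals (x - r) g(x) + r (g(x) - g(r)), and `k` is the quotient
  -- for the last bracket.
  ... | k , p′ , eq = (λ x → g x ⊕ r · k x)
    , polynomial-resp (trans (+-congˡ (zeroʳ r)) (+-identityʳ _)) (λ _ → refl)
        (polynomial-+ p (polynomial-· r (polynomial-suc p′)))
    , λ x → begin
    f x ⊕ r · (g x ⊕ r · k x)               ≈⟨ +-cong (eq′ x) (*-congˡ (eq x)) ⟩
    x · g x ⊕ b ⊕ r · (x · k x ⊕ g r)       ≈⟨ solve 6 (λ x r g k b c → (x :* g :+ b) :+ r :* (x :* k :+ c)
                                                 := x :* (g :+ r :* k) :+ (r :* c :+ b)) refl x r (g x) (k x) b (g r) ⟩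
    x · (g x ⊕ r · k x) ⊕ (r · g r ⊕ b)     ≈⟨ +-congˡ (eq′ r) ⟨
    x · (g x ⊕ r · k x) ⊕ f r               ∎

  quotient-root : ∀ {f g : Carrier → Carrier} {r x} → f x ⊕ r · g x ≈ x · g x ⊕ f r →
                  f r ≈ 0# → f x ≈ 0# → ¬ x ≈ r → g x ≈ 0#
  quotient-root {f} {g} {r} {x} eq fr≈0 fx≈0 x≉r = x·z≈y·z⇒z≈0 x≉r (begin
    x · g x          ≈⟨ +-identityʳ _ ⟨
    x · g x ⊕ 0#     ≈⟨ +-congˡ fr≈0 ⟨
    x · g x ⊕ f r    ≈⟨ eq ⟨
    f x ⊕ r · g x    ≈⟨ +-congʳ fx≈0 ⟩
    0# ⊕ r · g x     ≈⟨ +-identityˡ _ ⟩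
    r · g x          ∎)

  -- Several indices may share a root. Remove the fibre of `σ` over one root, at most `K` indices,
  -- and divide by its linear factor; the remaining indices still give roots of the quotient, so
  -- each degree costs at most `K`.
  roots-fibred : ∀ {d a f m} K → Polynomial d a f → ¬ a ≈ 0# → (σ : Fin m → Carrier) → (J : Subset m) →
    (∀ {j} → j ∈ˢ J → f (σ j) ≈ 0#) →
    (∀ r (I : Subset m) → I ⊆ J → (∀ {i} → i ∈ˢ I → σ i ≈ r) → ∣ I ∣ ≤ K) → ∣ J ∣ ≤ d * K
  roots-fibred K (constant eq) a≉0 σ J root fibre =
    ∣J∣≤0 λ {j} j∈J → a≉0 (trans (sym (eq (σ j))) (root j∈J))
  roots-fibred {suc d} {f = f} K p@(horner _ _) a≉0 σ J root fibre with nonempty? J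
  ... | no  empty = ℕₚ.≤-trans (∣J∣≤0 λ j∈J → empty (_ , j∈J)) z≤n
  ... | yes (i , i∈J) with split (λ j → σ j ≈? σ i) J | divide (σ i) p
  ...   | J₁ , J₂ , eq , f₁ , f₂ | g , p′ , eq′ = ≡.subst (_≤ K + d * K) (≡.sym eq) (ℕₚ.+-mono-≤
    (fibre (σ i) J₁ (proj₁ ∘ f₁) (proj₂ ∘ f₁))
    (roots-fibred K p′ a≉0 σ J₂
      (λ {j} j∈J₂ → quotient-root {f} {g} (eq′ (σ j)) (root i∈J) (root (proj₁ (f₂ j∈J₂))) (proj₂ (f₂ j∈J₂)))
      (λ r I I⊆J₂ → fibre r I (proj₁ ∘ f₂ ∘ I⊆J₂))))

  roots : ∀ {d a f m} → Polynomial d a f → ¬ a ≈ 0# → (σ : Fin m → Carrier) → (J : Subset m) →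
    (∀ {j} → j ∈ˢ J → f (σ j) ≈ 0#) → (∀ {i j} → i ∈ˢ J → j ∈ˢ J → σ i ≈ σ j → i ≡ j) → ∣ J ∣ ≤ d
  roots {d} p a≉0 σ J root injective = ≡.subst (∣ J ∣ ≤_) (ℕₚ.*-identityʳ d)
    (roots-fibred 1 p a≉0 σ J root λ r I I⊆J σ≈r →
      ∣J∣≤1 λ i∈I j∈I → injective (I⊆J i∈I) (I⊆J j∈I) (trans (σ≈r i∈I) (sym (σ≈r j∈I))))

  -- Vanishing leading coefficients are dropped one at a time; the nonzero value at `x` stops this
  -- before the polynomial is exhausted. Root counting needs such a coefficient.
  nonzero-leading : ∀ {d a f x} → Polynomial d a f → ¬ f x ≈ 0# →
                    ∃₂ λ d′ a′ → d′ ≤ d × ¬ a′ ≈ 0# × Polynomial d′ a′ f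
  nonzero-leading {zero} {a} {x = x} p@(constant eq) f≉0 = 0 , a , z≤n , (λ a≈0 → f≉0 (trans (eq x) a≈0)) , p
  nonzero-leading {suc d} {a} p f≉0 with a ≈? 0#
  ... | no  a≉0 = suc d , a , ℕₚ.≤-refl , a≉0 , p
  ... | yes a≈0 =
    let _ , p′ = polynomial-lower (polynomial-resp a≈0 (λ _ → refl) p)
        d′ , a′ , d′≤d , rest = nonzero-leading p′ f≉0
    in d′ , a′ , ℕₚ.m≤n⇒m≤1+n d′≤d , rest

  -- Clearing denominators in a sum of simple fractions.

  productOf : ∀ {n} → Vector Carrier n → Carrier → Carrier
  productOf {zero}  y x = 1#
  productOf {suc n} y x = (head y ⊕ x · 1#) · productOf (tail y) x

  productOf-polynomial : ∀ {n} (y : Vector Carrier n) → Polynomial n 1# (productOf y)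
  productOf-polynomial {zero}  y = constant λ _ → refl
  productOf-polynomial {suc n} y =
    polynomial-resp (*-identityˡ 1#) (λ _ → refl) (polynomial-linear (y zero) 1# (productOf-polynomial (tail y)))

  -- The numerator of the rational function ∑ w p / (y p + x).
  numerator : ∀ {n} → Vector Carrier n → Vector Carrier n → Carrier → Carrier
  numerator {zero}  y w x = 0#
  numerator {suc n} y w x = head w · productOf (tail y) x ⊕ (head y ⊕ x · 1#) · numerator (tail y) (tail w) x

  numerator-polynomial : ∀ {n} (y w : Vector Carrier n) → ∃ λ a → Polynomial n a (numerator y w)
  numerator-polynomial {zero}  y w = 0# , constant λ _ → refl
  numerator-polynomial {suc n} y w = let a , p = numerator-polynomial (tail y) (tail w) in _ ,
    polynomial-+ (polynomial-suc (polynomial-· (head w) (productOf-polynomial (tail y))))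
                 (polynomial-linear (head y) 1# p)

  -- Each fraction `w p / (y p + x)` is formally `b · u p`. The identity is free of division, so it
  -- also holds where some `y p + x` vanishes.
  numerator-sum : ∀ {n} (y w u : Vector Carrier n) x b → (∀ p → w p ≈ b · ((y p ⊕ x · 1#) · u p)) →
                  numerator y w x ≈ b · productOf y x · sum u
  numerator-sum {zero}  y w u x b eq = sym (zeroʳ _)
  numerator-sum {suc n} y w u x b eq = begin
    w zero · P ⊕ v · numerator (tail y) (tail w) x
      ≈⟨ +-cong (*-congʳ (eq zero)) (*-congˡ (numerator-sum (tail y) (tail w) (tail u) x b (eq ∘ suc))) ⟩
    b · (v · u zero) · P ⊕ v · (b · P · sum (tail u))
      ≈⟨ solve 5 (λ b v u P s → b :* (v :* u) :* P :+ v :* (b :* P :* s) := b :* (v :* P) :* (u :+ s)) refl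
           b v (u zero) P (sum (tail u)) ⟩
    b · (v · P) · (u zero ⊕ sum (tail u))  ∎
    where
    v = y zero ⊕ x · 1#
    P = productOf (tail y) x

  y-x·1≈0 : ∀ y → y ⊕ - y · 1# ≈ 0#
  y-x·1≈0 y = trans (+-congˡ (*-identityʳ (- y))) (-‿inverseʳ y)

  productOf-root : ∀ {n} (y : Vector Carrier n) t → productOf y (- y t) ≈ 0#
  productOf-root y zero    = trans (*-congʳ (y-x·1≈0 (y zero))) (zeroˡ _)
  productOf-root y (suc t) = trans (*-congˡ (productOf-root (tail y) t)) (zeroʳ _)

  productOf-nonroot : ∀ {n} (y : Vector Carrier n) x → (∀ p → ¬ y p ≈ x) → ¬ productOf y (- x) ≈ 0#
  productOf-nonroot {zero}  y x y≉x = 1≉0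
  productOf-nonroot {suc n} y x y≉x = x·y≉0
    (λ eq → y≉x zero (x∙y⁻¹≈ε⇒x≈y (y zero) x (trans (+-congˡ (sym (*-identityʳ (- x)))) eq)))
    (productOf-nonroot (tail y) x (y≉x ∘ suc))

  -- At `x = - y t` every summand containing the factor `y t + x` dies. What remains is `w t` times
  -- the product of the differences `y p - y t` over the other nodes.
  numerator-nonzero : ∀ {n} (y w : Vector Carrier n) → (∀ {i j} → y i ≈ y j → i ≡ j) →
                      ∀ t → ¬ w t ≈ 0# → ¬ numerator y w (- y t) ≈ 0#
  numerator-nonzero y w injective zero w≉0 eq =
    x·y≉0 w≉0 (productOf-nonroot (tail y) (y zero) λ p eq′ → Finₚ.0≢1+n (≡.sym (injective eq′)))
      (trans (sym (trans (+-congˡ (trans (*-congʳ (y-x·1≈0 (y zero))) (zeroˡ _))) (+-identityʳ _))) eq)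
  numerator-nonzero y w injective (suc t) w≉0 eq =
    x·y≉0 (λ eq′ → Finₚ.0≢1+n (injective (x∙y⁻¹≈ε⇒x≈y (y zero) (y (suc t))
             (trans (+-congˡ (sym (*-identityʳ _))) eq′))))
          (numerator-nonzero (tail y) (tail w) (Finₚ.suc-injective ∘ injective) t w≉0)
      (trans (sym (trans (+-congʳ (trans (*-congˡ (productOf-root (tail y) t)) (zeroʳ _))) (+-identityˡ _))) eq)

  -- Words orthogonal to polynomials of low degree.

  module Dual {N : ℕ} (y : Vector Carrier N) (y-injective : ∀ {p p′} → y p ≈ y p′ → p ≡ p′) (K : ℕ) where

    Orthogonal : Vector Carrier N → Set ℓ
    Orthogonal u = ∀ s → s < K → sum (λ p → y p ^ s · u p) ≈ 0#

    orthogonal-combine : ∀ {u v} a b → Orthogonal u → Orthogonal v → Orthogonal λ p → a · u p ⊕ b · v p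
    orthogonal-combine {u} {v} a b u⊥ v⊥ s s<K = begin
      sum (λ p → y p ^ s · (a · u p ⊕ b · v p))
        ≈⟨ sum-cong-≋ (λ p → solve 5 (λ y a u b v → y :* (a :* u :+ b :* v) := a :* (y :* u) :+ b :* (y :* v)) refl
             (y p ^ s) a (u p) b (v p)) ⟩
      sum (λ p → a · (y p ^ s · u p) ⊕ b · (y p ^ s · v p))
        ≈⟨ ∑-distrib-+ (λ p → a · (y p ^ s · u p)) _ ⟩
      sum (λ p → a · (y p ^ s · u p)) ⊕ sum (λ p → b · (y p ^ s · v p))
        ≈⟨ +-cong (*-distribˡ-sum a (λ p → y p ^ s · u p)) (*-distribˡ-sum b (λ p → y p ^ s · v p)) ⟨
      a · sum (λ p → y p ^ s · u p) ⊕ b · sum (λ p → y p ^ s · v p)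
        ≈⟨ +-cong (trans (*-congˡ (u⊥ s s<K)) (zeroʳ a)) (trans (*-congˡ (v⊥ s s<K)) (zeroʳ b)) ⟩
      0# ⊕ 0#
        ≈⟨ +-identityˡ 0# ⟩
      0#  ∎

    -- The weight `y p ^ s` makes the induction go through: a Horner step lowers the degree by one
    -- and raises `s` by one, leaving `d + s` fixed.
    orthogonal-polynomial : ∀ {u d a f} → Orthogonal u → Polynomial d a f → ∀ s → d + s < K →
                            sum (λ p → y p ^ s · (f (y p) · u p)) ≈ 0#
    orthogonal-polynomial {u} {a = a} {f} u⊥ (constant eq) s s<K = begin
      sum (λ p → y p ^ s · (f (y p) · u p))
        ≈⟨ sum-cong-≋ (λ p → trans (*-congˡ (*-congʳ (eq (y p))))
             (solve 3 (λ y a u → y :* (a :* u) := a :* (y :* u)) refl (y p ^ s) a (u p))) ⟩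
      sum (λ p → a · (y p ^ s · u p))
        ≈⟨ *-distribˡ-sum a (λ p → y p ^ s · u p) ⟨
      a · sum (λ p → y p ^ s · u p)
        ≈⟨ trans (*-congˡ (u⊥ s s<K)) (zeroʳ a) ⟩
      0#  ∎
    orthogonal-polynomial {u} {suc d} {f = f} u⊥ (horner {g = g} {b} p eq) s s<K = begin
      sum (λ p → y p ^ s · (f (y p) · u p))
        ≈⟨ sum-cong-≋ (λ p → trans (*-congˡ (*-congʳ (eq (y p))))
             (solve 5 (λ z y g b u → z :* ((y :* g :+ b) :* u) := y :* z :* (g :* u) :+ b :* (z :* u)) refl
               (y p ^ s) (y p) (g (y p)) b (u p))) ⟩
      sum (λ p → y p ^ suc s · (g (y p) · u p) ⊕ b · (y p ^ s · u p))
        ≈⟨ ∑-distrib-+ (λ p → y p ^ suc s · (g (y p) · u p)) _ ⟩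
      sum (λ p → y p ^ suc s · (g (y p) · u p)) ⊕ sum (λ p → b · (y p ^ s · u p))
        ≈⟨ +-cong (orthogonal-polynomial u⊥ p (suc s) (≡.subst (_< K) (≡.sym (ℕₚ.+-suc d s)) s<K))
                  (sym (*-distribˡ-sum b (λ p → y p ^ s · u p))) ⟩
      0# ⊕ b · sum (λ p → y p ^ s · u p)
        ≈⟨ trans (+-identityˡ _) (trans (*-congˡ (u⊥ s (ℕₚ.≤-trans (s≤s (ℕₚ.m≤n+m s (suc d))) s<K))) (zeroʳ b)) ⟩
      0#  ∎

    -- Dividing f by x - y t leaves a quotient g of smaller degree for which
    -- only the term at t can contribute to the vanishing sum ∑ g (y p) · u p.
    annihilator-zero : ∀ {u d a f t} → Orthogonal u → ¬ u t ≈ 0# → Polynomial d a f → d ≤ K →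
                       (∀ p → f (y p) · u p ≈ 0#) → a ≈ 0#
    annihilator-zero {u} {t = t} u⊥ ut≉0 (constant eq) d≤K fu≈0 =
      trans (sym (eq (y t))) (x·y≈0⇒y≈0 ut≉0 (trans (*-comm _ _) (fu≈0 t)))
    annihilator-zero {u} {suc d} {f = f} {t} u⊥ ut≉0 p@(horner _ _) d≤K fu≈0 with divide (y t) p
    ... | g , p′ , eq = annihilator-zero u⊥ ut≉0 p′ (ℕₚ.<⇒≤ d≤K) gu≈0
      where
      f≈0 : ∀ {p} → ¬ u p ≈ 0# → f (y p) ≈ 0#
      f≈0 {p} up≉0 = x·y≈0⇒y≈0 up≉0 (trans (*-comm _ _) (fu≈0 p))
      gu≈0-off : ∀ p → p ≢ t → g (y p) · u p ≈ 0#
      gu≈0-off p p≢t with u p ≈? 0#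
      ... | yes up≈0 = trans (*-congˡ up≈0) (zeroʳ _)
      ... | no  up≉0 = trans
        (*-congʳ (quotient-root {f} {g} (eq (y p)) (f≈0 ut≉0) (f≈0 up≉0) (p≢t ∘ y-injective))) (zeroˡ _)
      gu≈0 : ∀ p → g (y p) · u p ≈ 0#
      gu≈0 p with p ≟ t
      ... | no  p≢t    = gu≈0-off p p≢t
      ... | yes ≡.refl = begin
        g (y t) · u t                       ≈⟨ sum-single (λ p → g (y p) · u p) t gu≈0-off ⟨
        sum (λ p → g (y p) · u p)           ≈⟨ sum-cong-≋ (λ p → *-identityˡ (g (y p) · u p)) ⟨
        sum (λ p → 1# · (g (y p) · u p))
          ≈⟨ orthogonal-polynomial u⊥ p′ 0 (≡.subst (_< K) (≡.sym (ℕₚ.+-identityʳ d)) d≤K) ⟩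
        0#                                  ∎

    -- The difference of `u` and `v` is orthogonal and annihilated by `f`; if it were nonzero at
    -- some `p`, `annihilator-zero` would make the leading coefficient vanish.
    orthogonal-determined : ∀ {u v d a f} → Orthogonal u → Orthogonal v → Polynomial d a f → ¬ a ≈ 0# → d ≤ K →
                            (∀ p → f (y p) · u p ≈ f (y p) · v p) → ∀ p → u p ≈ v p
    orthogonal-determined {u} {v} {f = f} u⊥ v⊥ poly a≉0 d≤K eq p with u p ≈? v p
    ... | yes up≈vp = up≈vp
    ... | no  up≉vp = contradiction
      (annihilator-zero {u = λ p → 1# · u p ⊕ (- 1#) · v p} {t = p} (orthogonal-combine 1# (- 1#) u⊥ v⊥)
        (λ d≈0 → up≉vp (x∙y⁻¹≈ε⇒x≈y (u p) (v p) (trans (sym (difference (u p) (v p))) d≈0))) poly d≤K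
        (λ p → begin
          f (y p) · (1# · u p ⊕ - 1# · v p)      ≈⟨ *-congˡ (difference (u p) (v p)) ⟩
          f (y p) · (u p - v p)                  ≈⟨ distribˡ _ _ _ ⟩
          f (y p) · u p ⊕ f (y p) · - v p        ≈⟨ +-congˡ (-‿distribʳ-* _ _) ⟨
          f (y p) · u p - f (y p) · v p          ≈⟨ x≈y⇒x∙y⁻¹≈ε (eq p) ⟩
          0#                                     ∎)) a≉0

  -- Distinctness of powers of a primitive element.

  module _ {γ : Carrier} (γ-primitive : IsPrimitive F γ) where

    -- Every nonzero element is a power of `γ` whose exponent matters only modulo `suc d`. Together
    -- with zero this leaves room for at most `d + 2` elements.
    q≤1+order : ∀ {d} → γ ^ suc d ≈ 1# → q ≤ suc (suc d)
    q≤1+order {d} γ^D≈1 = Finₚ.injective⇒≤ {f = index ∘ Inverse.from finite} λ {i} {j} eq →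
      ≡.trans (≡.sym (Inverse.strictlyInverseˡ finite i))
        (≡.trans (Inverse.to-cong finite (index-injective _ _ eq)) (Inverse.strictlyInverseˡ finite j))
      where
      reduce : ∀ m → γ ^ m ≈ γ ^ toℕ (m mod suc d)
      reduce m = begin
        γ ^ m                                         ≡⟨ ≡.cong (γ ^_) (DivMod.property (m divMod suc d)) ⟩
        γ ^ (toℕ (m mod suc d) + m / suc d * suc d)   ≈⟨ ^-homo-* γ (toℕ (m mod suc d)) _ ⟩
        γ ^ toℕ (m mod suc d) · γ ^ (m / suc d * suc d)
          ≈⟨ *-congˡ (trans (^-congʳ γ (ℕₚ.*-comm (m / suc d) (suc d))) (sym (^-assocʳ γ (suc d) (m / suc d)))) ⟩
        γ ^ toℕ (m mod suc d) · (γ ^ suc d) ^ (m / suc d)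
          ≈⟨ *-congˡ (trans (^-congˡ (m / suc d) γ^D≈1) (1^n≈1 (m / suc d))) ⟩
        γ ^ toℕ (m mod suc d) · 1#                    ≈⟨ *-identityʳ _ ⟩
        γ ^ toℕ (m mod suc d)                         ∎
        where
        1^n≈1 : ∀ n → 1# ^ n ≈ 1#
        1^n≈1 zero    = refl
        1^n≈1 (suc n) = trans (*-identityˡ _) (1^n≈1 n)
      index : Carrier → Fin (suc (suc d))
      index x with x ≈? 0#
      ... | yes _   = zero
      ... | no  x≉0 = suc (proj₁ (proj₂ γ-primitive x x≉0) mod suc d)
      index-injective : ∀ x y → index x ≡ index y → x ≈ y
      index-injective x y eq with x ≈? 0# | y ≈? 0#
      ... | yes x≈0 | yes y≈0 = trans x≈0 (sym y≈0)
      ... | no  x≉0 | no  y≉0 = begin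
        x                          ≈⟨ proj₂ (proj₂ γ-primitive x x≉0) ⟩
        γ ^ m                      ≈⟨ reduce m ⟩
        γ ^ toℕ (m mod suc d)      ≡⟨ ≡.cong (λ i → γ ^ toℕ i) (Finₚ.suc-injective eq) ⟩
        γ ^ toℕ (m′ mod suc d)     ≈⟨ reduce m′ ⟨
        γ ^ m′                     ≈⟨ proj₂ (proj₂ γ-primitive y y≉0) ⟨
        y                          ∎
        where
        m  = proj₁ (proj₂ γ-primitive x x≉0)
        m′ = proj₁ (proj₂ γ-primitive y y≉0)

    -- Equality would give `γ ^ (j - i) ≈ 1#`, hence `q ≤ j - i + 1 ≤ j + 1`.
    powers-distinct : ∀ {i j} → i < j → suc j < q → ¬ γ ^ i ≈ γ ^ j
    powers-distinct {i} {j} i<j j<q eq = ℕₚ.<⇒≱ j<q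
      (ℕₚ.≤-trans (q≤1+order γ^d≈1) (s≤s (≡.subst (suc d ≤_) (≡.sym j≡) (s≤s (ℕₚ.m≤n+m d i)))))
      where
      d = proj₁ (ℕₚ.m≤n⇒∃[o]m+o≡n i<j)
      j≡ : j ≡ suc (i + d)
      j≡ = ≡.sym (proj₂ (ℕₚ.m≤n⇒∃[o]m+o≡n i<j))
      γ^d≈1 : γ ^ suc d ≈ 1#
      γ^d≈1 = ·-cancelˡ (x^n≉0 (proj₁ γ-primitive) i) (begin
        γ ^ i · γ ^ suc d   ≈⟨ ^-homo-* γ i (suc d) ⟨
        γ ^ (i + suc d)     ≡⟨ ≡.cong (γ ^_) (≡.trans (ℕₚ.+-suc i d) (≡.sym j≡)) ⟩
        γ ^ j               ≈⟨ eq ⟨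
        γ ^ i               ≈⟨ *-identityʳ _ ⟨
        γ ^ i · 1#          ∎)

    powers-injective : ∀ {N} → N < q → ∀ {p p′ : Fin N} → γ ^ toℕ p ≈ γ ^ toℕ p′ → p ≡ p′
    powers-injective N<q {p} {p′} eq with Finₚ.<-cmp p p′
    ... | tri< p<p′ _ _ = contradiction eq (powers-distinct p<p′ (ℕₚ.≤-<-trans (Finₚ.toℕ<n p′) N<q))
    ... | tri≈ _ p≡p′ _ = p≡p′
    ... | tri> _ _ p′<p = contradiction (sym eq) (powers-distinct p′<p (ℕₚ.≤-<-trans (Finₚ.toℕ<n p) N<q))

  -- The code and the coordinate forms of the family.

  module Construction {k′ n : ℕ} (2k<n : 2 * suc k′ < n) (n≤q : n ≤ q)
                      {γ : Carrier} (γ-primitive : IsPrimitive F γ) where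

    k : ℕ
    k = suc k′

    N : ℕ
    N = codeLength F n k γ

    N<q : N < q
    N<q = ℕₚ.<-≤-trans (ℕₚ.≤-<-trans (ℕₚ.m∸n≤m (n ∸ k) 1) (ℕₚ.∸-monoʳ-< (s≤s z≤n)
      (ℕₚ.<⇒≤ (ℕₚ.≤-<-trans (ℕₚ.m≤m+n k (k + 0)) 2k<n)))) n≤q

    open Dual {N} (λ p → γ ^ toℕ p) (powers-injective γ-primitive N<q) k′

    -- Row `s` of the parity-check matrix lists the values of the monomial of degree `s` at the
    -- nodes `γ ^ p`.
    codeword-orthogonal : ∀ {x} → IsCodeword F n k γ x → Orthogonal x
    codeword-orthogonal {x} x∈C s s<K = begin
      sum (λ p → (γ ^ toℕ p) ^ s · x p)
        ≈⟨ sum-cong-≋ {N} (λ p → *-congʳ (trans (^-assocʳ γ (toℕ p) s)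
             (^-congʳ γ (≡.cong (toℕ p *_) (≡.sym (Finₚ.toℕ-fromℕ< s<K)))))) ⟩
      sum (λ p → parityCheck F n k γ (Fin.fromℕ< s<K) p · x p)
        ≈⟨ x∈C (Fin.fromℕ< s<K) ⟩
      0#  ∎

    -- In the member with codeword `x`, the vector with first `k` coordinates `b` has code
    -- coordinates `A b p · x p` and last coordinate `H b x`.
    A : Vector Carrier k → Vector Carrier N
    A b p = sum λ j → b j · γ ^ (suc (toℕ p) * toℕ j)

    H : Vector Carrier k → Vector Carrier N → Carrier
    H b x = sum λ j → b j · h F n k γ j x

    A-cong : ∀ {a b : Vector Carrier k} → (∀ j → a j ≈ b j) → ∀ p → A a p ≈ A b p
    A-cong a≈b p = sum-cong-≋ λ j → *-congʳ {γ ^ (suc (toℕ p) * toℕ j)} (a≈b j)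

    H-cong : ∀ {a b : Vector Carrier k} {x y : Vector Carrier N} → (∀ j → a j ≈ b j) → (∀ p → x p ≈ y p) → H a x ≈ H b y
    H-cong a≈b x≈y = sum-cong-≋ λ j → *-cong (a≈b j)
      (sum-cong-≋ {N} λ p → ^-congˡ (toℕ j * N + toℕ p + 2) (x≈y p))

    sum-+ : ∀ {m} (a b g : Vector Carrier m) →
            sum (λ j → (a j ⊕ b j) · g j) ≈ sum (λ j → a j · g j) ⊕ sum (λ j → b j · g j)
    sum-+ a b g = trans (sum-cong-≋ λ j → distribʳ (g j) (a j) (b j)) (∑-distrib-+ (λ j → a j · g j) _)

    sum-scale : ∀ {m} r (a g : Vector Carrier m) → sum (λ j → (r · a j) · g j) ≈ r · sum (λ j → a j · g j)
    sum-scale r a g = trans (sum-cong-≋ λ j → *-assoc r (a j) (g j)) (sym (*-distribˡ-sum r λ j → a j · g j))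

    -- With `x = γ ^ p` the base `x · γ` is `γ ^ (p + 1)`, so this is `A b` as a polynomial in the
    -- nodes of the code. The base has the shape that `polynomial-power` produces.
    A-polynomial : ∀ (b : Vector Carrier k) j → (∀ i → j Fin.< i → b i ≈ 0#) →
                   Polynomial (toℕ j) (b j · γ ^ toℕ j) λ x → sum λ i → b i · (0# ⊕ x · γ) ^ toℕ i
    A-polynomial b j b≈0 = polynomial-sum-dominant {e = toℕ} j (λ i i<j → i<j)
      (λ i → polynomial-· (b i) (polynomial-power 0# γ (toℕ i)))
      (λ i j<i → polynomial-zero λ x → trans (*-congʳ (b≈0 i j<i)) (zeroˡ _))

    A-eval : ∀ b p → sum (λ i → b i · (0# ⊕ γ ^ toℕ p · γ) ^ toℕ i) ≈ A b p
    A-eval b p = sum-cong-≋ λ i → *-congˡ {b i} (trans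
      (^-congˡ (toℕ i) (trans (+-identityˡ _) (*-comm (γ ^ toℕ p) γ))) (^-assocʳ γ (suc (toℕ p)) (toℕ i)))

    -- A nonzero `b` makes `A b` a nonzero polynomial of degree at most `k - 1` in the nodes, within
    -- reach of `orthogonal-determined`. This is the minimum distance `k` at work.
    A-determined : ∀ {u v : Vector Carrier N} (b : Vector Carrier k) → Orthogonal u → Orthogonal v → ¬ (∀ j → b j ≈ 0#) →
                   (∀ p → A b p · u p ≈ A b p · v p) → ∀ p → u p ≈ v p
    A-determined b u⊥ v⊥ b≉0 eq with lastNonzero b
    ... | inj₂ b≈0 = contradiction b≈0 b≉0
    ... | inj₁ (j , bj≉0 , b≈0) = orthogonal-determined {f = λ x → sum λ i → b i · (0# ⊕ x · γ) ^ toℕ i} u⊥ v⊥ (A-polynomial b j b≈0)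
      (x·y≉0 bj≉0 (x^n≉0 (proj₁ γ-primitive) (toℕ j))) (s≤s⁻¹ (Finₚ.toℕ<n j))
      (λ p → trans (*-congʳ (A-eval b p)) (trans (eq p) (*-congʳ (sym (A-eval b p)))))

    -- The exponents `j N + t + 2` increase lexicographically in `(j , t)` because `t < N`. Hence
    -- the last nonzero entries of `b` and `u` give the leading term.
    H-polynomial : ∀ (x u : Vector Carrier N) (b : Vector Carrier k) j t → (∀ i → j Fin.< i → b i ≈ 0#) → (∀ p → t Fin.< p → u p ≈ 0#) →
      let d = toℕ j * N + toℕ t + 2 in Polynomial d (b j · u t ^ d) λ s → H b λ p → x p ⊕ s · u p
    H-polynomial x u b j t b≈0 u≈0 = polynomial-sum-dominant {e = degree} j
      (λ i i<j → ℕₚ.+-monoˡ-< 2 (ℕₚ.+-monoˡ-< (toℕ t) (ℕₚ.*-monoˡ-< N ⦃ Finₚ.nonZeroIndex t ⦄ i<j)))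
      (λ i → polynomial-· (b i) (inner i))
      (λ i j<i → polynomial-zero λ s → trans (*-congʳ (b≈0 i j<i)) (zeroˡ _))
      where
      degree : Fin k → ℕ
      degree i = toℕ i * N + toℕ t + 2
      inner : ∀ i → Polynomial (degree i) (u t ^ degree i) λ s → sum λ p → (x p ⊕ s · u p) ^ (toℕ i * N + toℕ p + 2)
      inner i = polynomial-sum-dominant {e = λ p → toℕ i * N + toℕ p + 2} t
        (λ p p<t → ℕₚ.+-monoˡ-< 2 (ℕₚ.+-monoʳ-< (toℕ i * N) p<t))
        (λ p → polynomial-power (x p) (u p) (toℕ i * N + toℕ p + 2))
        -- Beyond `t` the coordinate does not move with `s`, so the term is a constant, and degree 0
        -- is below an exponent that is at least 2.
        (λ p t<p → polynomial-raise (ℕₚ.≤-trans (s≤s z≤n) (ℕₚ.m≤n+m 2 (toℕ i * N + toℕ t)))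
          (constant λ s → ^-congˡ (toℕ i * N + toℕ p + 2)
            (trans (+-congˡ (trans (*-congˡ (u≈0 p t<p)) (zeroʳ s))) (+-identityʳ (x p)))))

    -- The condition on b for u + S to meet the member with codeword x′, where S
    -- is the member with codeword x and u is normalised to (0 , w , w∞).
    Meets : Vector Carrier N → Vector Carrier N → Carrier → Vector Carrier N → Vector Carrier k → Set ℓ
    Meets x w w∞ x′ b = (∀ p → w p ⊕ A b p · x p ≈ A b p · x′ p) × w∞ ⊕ H b x ≈ H b x′

    -- Members met with coefficients on one line through the origin.

    module Meeting {m : ℕ} {x w : Vector Carrier N} {w∞ : Carrier} (x⊥ : Orthogonal x)
      (nontrivial : ¬ ((∀ p → w p ≈ 0#) × w∞ ≈ 0#))
      (C : Fin m → Vector Carrier N) (C⊥ : ∀ i → Orthogonal (C i))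
      (C-injective : ∀ {i j} → (∀ p → C i p ≈ C j p) → i ≡ j)
      (b : Fin m → Vector Carrier k) (J : Subset m) (meets : ∀ {j} → j ∈ˢ J → Meets x w w∞ (C j) (b j)) where

      b≉0 : ∀ {j} → j ∈ˢ J → ¬ (∀ i → b j i ≈ 0#)
      b≉0 {j} j∈J b≈0 = nontrivial
        ( (λ p → x⊕y≈y⇒x≈0 (proj₁ (meets j∈J) p) (zero-factor (A-zero p)))
        , x⊕y≈y⇒x≈0 (proj₂ (meets j∈J)) (trans (sum-vanish λ i → h F n k γ i x) (sym (sum-vanish λ i → h F n k γ i (C j)))))
        where
        sum-vanish : (g : Vector Carrier k) → sum (λ i → b j i · g i) ≈ 0#
        sum-vanish g = sum-zero λ i → trans (*-congʳ (b≈0 i)) (zeroˡ (g i))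
        A-zero : ∀ p → A (b j) p ≈ 0#
        A-zero p = sum-vanish λ i → γ ^ (suc (toℕ p) * toℕ i)
        zero-factor : ∀ {a y z} → a ≈ 0# → a · y ≈ a · z
        zero-factor a≈0 = trans (*-congʳ a≈0) (trans (zeroˡ _) (sym (trans (*-congʳ a≈0) (zeroˡ _))))

      -- With equal codewords the terms in `x` and `C j` cancel from `Meets`, leaving `w` and `w∞`
      -- zero.
      C≉x : ∀ {j} → j ∈ˢ J → ¬ (∀ p → C j p ≈ x p)
      C≉x {j} j∈J C≈x = nontrivial
        ( (λ p → x⊕y≈y⇒x≈0 (proj₁ (meets j∈J) p) (*-congˡ (sym (C≈x p))))
        , x⊕y≈y⇒x≈0 (proj₂ (meets j∈J)) (H-cong (λ i → refl {b j i}) (λ p → sym (C≈x p))))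

      module Line (I : Subset m) (I⊆J : I ⊆ J) (α : Vector Carrier k) (r : Fin m → Carrier)
                  (b≈rα : ∀ {j} → j ∈ˢ I → ∀ i → b j i ≈ r j · α i) where

        r≉0 : ∀ {j} → j ∈ˢ I → ¬ r j ≈ 0#
        r≉0 j∈I r≈0 = b≉0 (I⊆J j∈I) λ i → trans (b≈rα j∈I i) (trans (*-congʳ r≈0) (zeroˡ (α i)))

        α≉0 : ∀ {j} → j ∈ˢ I → ¬ (∀ i → α i ≈ 0#)
        α≉0 {j} j∈I α≈0 = b≉0 (I⊆J j∈I) λ i → trans (b≈rα j∈I i) (trans (*-congˡ (α≈0 i)) (zeroʳ (r j)))

        -- The inverse of `r j` will be the parameter of `C j` on the common line of codewords.
        inverses : ∃ λ (s : Fin m → Carrier) → ∀ {j} → j ∈ˢ I → s j · r j ≈ 1#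
        inverses = chooseOn {R = λ j s → s · r j ≈ 1#} 0# I (inverse ∘ r≉0)

        s : Fin m → Carrier
        s = proj₁ inverses

        A-meets : ∀ {j} → j ∈ˢ I → ∀ p → w p ⊕ r j · A α p · x p ≈ r j · A α p · C j p
        A-meets {j} j∈I p = trans (+-congˡ (*-congʳ (sym A≈))) (trans (proj₁ (meets (I⊆J j∈I)) p) (*-congʳ A≈))
          where
          A≈ : A (b j) p ≈ r j · A α p
          A≈ = trans (A-cong (b≈rα j∈I) p) (sum-scale (r j) α λ i → γ ^ (suc (toℕ p) * toℕ i))

        -- Division by `r j` leaves an equation that depends on `j` only through `s j` and `C j`.
        H-meets : ∀ {j} → j ∈ˢ I → s j · w∞ ⊕ H α x ≈ H α (C j)
        H-meets {j} j∈I = begin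
          s j · w∞ ⊕ H α x                    ≈⟨ +-congˡ (rescale (H α x)) ⟩
          s j · w∞ ⊕ s j · (r j · H α x)      ≈⟨ distribˡ _ _ _ ⟨
          s j · (w∞ ⊕ r j · H α x)            ≈⟨ *-congˡ (+-congˡ (sym (H≈ x))) ⟩
          s j · (w∞ ⊕ H (b j) x)              ≈⟨ *-congˡ (proj₂ (meets (I⊆J j∈I))) ⟩
          s j · H (b j) (C j)                 ≈⟨ *-congˡ (H≈ (C j)) ⟩
          s j · (r j · H α (C j))             ≈⟨ rescale (H α (C j)) ⟨
          H α (C j)                           ∎
          where
          H≈ : ∀ z → H (b j) z ≈ r j · H α z
          H≈ z = trans (H-cong {x = z} (b≈rα j∈I) (λ p → refl)) (sum-scale (r j) α λ i → h F n k γ i z)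
          rescale : ∀ z → z ≈ s j · (r j · z)
          rescale z = trans (sym (*-identityˡ z)) (trans (*-congʳ (sym (proj₂ inverses j∈I))) (*-assoc (s j) (r j) z))

        -- The members met along the direction α have codewords on one affine line through x.
        collinear : ∀ {i j} → i ∈ˢ I → j ∈ˢ I → ∀ p → r j · C j p ⊕ r i · x p ≈ r i · C i p ⊕ r j · x p
        collinear {i} {j} i∈I j∈I = A-determined α
          (orthogonal-combine (r j) (r i) (C⊥ j) x⊥) (orthogonal-combine (r i) (r j) (C⊥ i) x⊥) (α≉0 i∈I)
          λ p → trans (one-side p j∈I) (trans (swap p) (sym (one-side p i∈I)))
          where
          one-side : ∀ {i j} p → j ∈ˢ I →
            A α p · (r j · C j p ⊕ r i · x p) ≈ w p ⊕ r j · A α p · x p ⊕ A α p · (r i · x p)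
          one-side {i} {j} p j∈I = begin
            A α p · (r j · C j p ⊕ r i · x p)
              ≈⟨ solve 5 (λ a r c r′ x → a :* (r :* c :+ r′ :* x) := r :* a :* c :+ a :* (r′ :* x)) refl
                   (A α p) (r j) (C j p) (r i) (x p) ⟩
            r j · A α p · C j p ⊕ A α p · (r i · x p)
              ≈⟨ +-congʳ (A-meets j∈I p) ⟨
            w p ⊕ r j · A α p · x p ⊕ A α p · (r i · x p)  ∎
          swap : ∀ p → w p ⊕ r j · A α p · x p ⊕ A α p · (r i · x p) ≈ w p ⊕ r i · A α p · x p ⊕ A α p · (r j · x p)
          swap p = solve 5 (λ w r a x r′ → w :+ r :* a :* x :+ a :* (r′ :* x) := w :+ r′ :* a :* x :+ a :* (r :* x))
            refl (w p) (r j) (A α p) (x p) (r i)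

        module _ {o : Fin m} (o∈I : o ∈ˢ I) where

          -- The direction of the line of codewords. It is `w p / A α p` wherever `A α p` is
          -- nonzero; since `A α` may have zeros, one member `o` supplies it instead.
          D : Vector Carrier N
          D p = r o · (C o p - x p)

          D⊕x : ∀ p → D p ⊕ r o · x p ≈ r o · C o p
          D⊕x p = begin
            D p ⊕ r o · x p              ≈⟨ distribˡ (r o) _ _ ⟨
            r o · (C o p - x p ⊕ x p)
              ≈⟨ *-congˡ (trans (+-assoc _ _ _) (trans (+-congˡ (-‿inverseˡ (x p))) (+-identityʳ (C o p)))) ⟩
            r o · C o p                  ∎

          D≉0 : ¬ (∀ p → D p ≈ 0#)
          D≉0 D≈0 = C≉x (I⊆J o∈I) λ p → x∙y⁻¹≈ε⇒x≈y (C o p) (x p) (x·y≈0⇒y≈0 (r≉0 o∈I) (D≈0 p))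

          -- This is `collinear` with `o`, divided by `r j`; the summand added on both sides avoids
          -- subtraction.
          on-line : ∀ {j} → j ∈ˢ I → ∀ p → C j p ≈ x p ⊕ s j · D p
          on-line {j} j∈I p = ∙-cancelʳ (s j · (r o · x p)) _ _ (begin
            C j p ⊕ s j · (r o · x p)
              ≈⟨ +-congʳ (trans (sym (*-identityˡ _)) (*-congʳ (sym (proj₂ inverses j∈I)))) ⟩
            s j · r j · C j p ⊕ s j · (r o · x p)
              ≈⟨ solve 4 (λ s r c y → s :* r :* c :+ s :* y := s :* (r :* c :+ y)) refl (s j) (r j) (C j p) (r o · x p) ⟩
            s j · (r j · C j p ⊕ r o · x p)
              ≈⟨ *-congˡ (trans (collinear o∈I j∈I p) (+-congʳ (sym (D⊕x p)))) ⟩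
            s j · (D p ⊕ r o · x p ⊕ r j · x p)
              ≈⟨ solve 5 (λ s d y r x → s :* (d :+ y :+ r :* x) := (s :* r) :* x :+ s :* d :+ s :* y) refl
                   (s j) (D p) (r o · x p) (r j) (x p) ⟩
            s j · r j · x p ⊕ s j · D p ⊕ s j · (r o · x p)
              ≈⟨ +-congʳ (+-congʳ (trans (*-congʳ (proj₂ inverses j∈I)) (*-identityˡ (x p)))) ⟩
            x p ⊕ s j · D p ⊕ s j · (r o · x p)  ∎)

          -- The equation of `H-meets` with `C j` replaced by a general point of the line.
          Q : Carrier → Carrier
          Q z = H α (λ p → x p ⊕ z · D p) - (z · w∞ ⊕ H α x)

          Q-root : ∀ {j} → j ∈ˢ I → Q (s j) ≈ 0#
          Q-root j∈I = x≈y⇒x∙y⁻¹≈ε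
            (trans (H-cong (λ i → refl {α i}) (λ p → sym (on-line j∈I p))) (sym (H-meets j∈I)))

          -- The subtracted part has degree 1 in the parameter. All exponents in `h` are at least 2,
          -- so the leading coefficient from `H-polynomial` is untouched.
          Q-polynomial : ∀ j t → (∀ i → j Fin.< i → α i ≈ 0#) → (∀ p → t Fin.< p → D p ≈ 0#) →
            let d = toℕ j * N + toℕ t + 2 in Polynomial d (α j · D t ^ d) Q
          Q-polynomial j t α≈0 D≈0 = polynomial-resp (+-identityʳ _) (λ _ → refl)
            (polynomial-+ (H-polynomial x D α j t α≈0 D≈0)
              (polynomial-raise (ℕₚ.m≤n+m 2 (toℕ j * N + toℕ t)) linear))
            where
            linear : Polynomial 1 (- w∞) λ z → - (z · w∞ ⊕ H α x)
            linear = horner (constant λ _ → refl) λ z →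
              trans (sym (-‿+-comm (z · w∞) (H α x))) (+-congʳ (-‿distribʳ-* z w∞))

        -- The parameters `s j` are roots of `Q`, which has a nonzero leading coefficient. They are
        -- distinct because `s j` determines `C j` by `on-line`, and the enumeration is injective.
        line-bound : ∣ I ∣ ≤ k * N + 1
        line-bound with nonempty? I
        ... | no  empty = ℕₚ.≤-trans (∣J∣≤0 λ j∈I → empty (_ , j∈I)) z≤n
        ... | yes (o , o∈I) with lastNonzero α | lastNonzero (D o∈I)
        ...   | inj₂ α≈0 | _        = contradiction α≈0 (α≉0 o∈I)
        ...   | inj₁ _   | inj₂ D≈0 = contradiction D≈0 (D≉0 o∈I)
        ...   | inj₁ (j , αj≉0 , α≈0) | inj₁ (t , Dt≉0 , D≈0) = ℕₚ.≤-trans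
          (roots (Q-polynomial o∈I j t α≈0 D≈0) (x·y≉0 αj≉0 (x^n≉0 Dt≉0 (toℕ j * N + toℕ t + 2))) s I (Q-root o∈I)
            λ i∈I j∈I si≈sj → C-injective λ p →
              trans (on-line o∈I i∈I p) (trans (+-congˡ (*-congʳ si≈sj)) (sym (on-line o∈I j∈I p))))
          (degree-bound j t)

    -- Coordinates of the generators and their combinations.

    open VectorEquality setoid using (_≋_)

    n≡ : k + (N + 1) ≡ n
    n≡ = length-≡ F n k γ 2k<n

    unitPosition : Fin k → Fin n
    unitPosition i = Fin.cast n≡ (i Fin.↑ˡ (N + 1))

    codePosition : Fin N → Fin n
    codePosition p = Fin.cast n≡ (k Fin.↑ʳ (p Fin.↑ˡ 1))

    lastPosition : Fin n
    lastPosition = Fin.cast n≡ (k Fin.↑ʳ (N Fin.↑ʳ zero))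

    position-elim : ∀ {a} (P : Fin n → Set a) → (∀ i → P (unitPosition i)) → (∀ p → P (codePosition p)) →
                    P lastPosition → ∀ i → P i
    position-elim P unit code last i =
      ≡.subst P (Finₚ.cast-involutive n≡ (≡.sym n≡) i) (all (Fin.cast (≡.sym n≡) i))
      where
      right : ∀ p → P (Fin.cast n≡ (k Fin.↑ʳ p))
      right p = ≡.subst (λ p → P (Fin.cast n≡ (k Fin.↑ʳ p))) (Finₚ.join-splitAt N 1 p) (go (Fin.splitAt N p))
        where
        go : ∀ s → P (Fin.cast n≡ (k Fin.↑ʳ Fin.join N 1 s))
        go (inj₁ p)    = code p
        go (inj₂ zero) = last
      all : ∀ p → P (Fin.cast n≡ p)
      all p = ≡.subst (P ∘ Fin.cast n≡) (Finₚ.join-splitAt k (N + 1) p) (go (Fin.splitAt k p))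
        where
        go : ∀ s → P (Fin.cast n≡ (Fin.join k (N + 1) s))
        go (inj₁ i) = unit i
        go (inj₂ p) = right p

    module _ (x : Vector Carrier N) where

      gen : Fin k → Vector Carrier n
      gen = generator F n k γ 2k<n x

      gen-at : ∀ j p → gen j (Fin.cast n≡ p) ≡ (e F n k γ j ++ (Γ F n k γ j x ++ replicate 1 (h F n k γ j x))) p
      gen-at j p = ≡.cong (e F n k γ j ++ (Γ F n k γ j x ++ replicate 1 (h F n k γ j x)))
        (Finₚ.cast-involutive (≡.sym n≡) n≡ p)

      gen-unit : ∀ j i → gen j (unitPosition i) ≡ e F n k γ j i
      gen-unit j i = ≡.trans (gen-at j _) (lookup-++ˡ (e F n k γ j) _ i)

      gen-code : ∀ j p → gen j (codePosition p) ≡ Γ F n k γ j x p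
      gen-code j p = ≡.trans (gen-at j _)
        (≡.trans (lookup-++ʳ (e F n k γ j) _ (p Fin.↑ˡ 1)) (lookup-++ˡ (Γ F n k γ j x) _ p))

      gen-last : ∀ j → gen j lastPosition ≡ h F n k γ j x
      gen-last j = ≡.trans (gen-at j _)
        (≡.trans (lookup-++ʳ (e F n k γ j) _ (N Fin.↑ʳ zero)) (lookup-++ʳ (Γ F n k γ j x) _ zero))

      combination : Vector Carrier k → Vector Carrier n
      combination a = linearCombination F a gen

      -- The blocks `e j` make the coefficients readable from the first `k` coordinates. This yields
      -- linear independence and identifies the coefficients of a vector lying in two members.
      combination-unit : ∀ a i → combination a (unitPosition i) ≈ a i
      combination-unit a i = trans (sum-single (λ j → a j · gen j (unitPosition i)) i off)
        (trans (*-congˡ (trans (reflexive (gen-unit i i)) diagonal)) (*-identityʳ (a i)))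
        where
        diagonal : e F n k γ i i ≈ 1#
        diagonal with i ≟ i
        ... | yes _  = refl
        ... | no i≢i = contradiction ≡.refl i≢i
        off-diagonal : ∀ j → j ≢ i → e F n k γ j i ≈ 0#
        off-diagonal j j≢i with i ≟ j
        ... | yes i≡j = contradiction (≡.sym i≡j) j≢i
        ... | no _    = refl
        off : ∀ j → j ≢ i → a j · gen j (unitPosition i) ≈ 0#
        off j j≢i = trans (*-congˡ (trans (reflexive (gen-unit j i)) (off-diagonal j j≢i))) (zeroʳ (a j))

      combination-code : ∀ a p → combination a (codePosition p) ≈ A a p · x p
      combination-code a p = trans
        (sum-cong-≋ λ j → trans (*-congˡ {a j} (reflexive (gen-code j p))) (sym (*-assoc (a j) _ (x p))))
        (sym (*-distribʳ-sum (x p) (λ j → a j · γ ^ (suc (toℕ p) * toℕ j))))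

      combination-last : ∀ a → combination a lastPosition ≈ H a x
      combination-last a = sum-cong-≋ λ j → *-congˡ {a j} (reflexive (gen-last j))

    -- The partial spread property and the normalisation of a translate.

    module Family (enum : CodewordEnumeration F n k γ) where

      m : ℕ
      m = q ℕ.^ (n ∸ 2 * k)

      𝓕 : Vector (Subspace F n) m
      𝓕 = family F n k γ 2k<n enum

      C : Fin m → Vector Carrier N
      C i = proj₁ (Bijection.to enum i)

      C⊥ : ∀ i → Orthogonal (C i)
      C⊥ i = codeword-orthogonal (proj₂ (Bijection.to enum i))

      C-injective : ∀ {i j} → (∀ p → C i p ≈ C j p) → i ≡ j
      C-injective = Bijection.injective enum

      isPartialSpread : IsPartialSpread F n k 𝓕
      isPartialSpread = record
        { dimension = λ i → gen (C i)
          , (λ a eq j → trans (sym (combination-unit (C i) a j)) (eq (unitPosition j)))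
          , (λ z → z) , (λ z → z)
        ; trivialIntersection = trivial
        }
        where
        trivial : ∀ {i j} → i ≢ j → ∀ v → Subspace.∣S∣ (𝓕 i) v → Subspace.∣S∣ (𝓕 j) v → v ≋ 0ᵛ F
        -- If the coefficients vanish, so does `v`. Otherwise both members use the same nonzero
        -- coefficients for `v`, and comparing code coordinates forces equal codewords.
        trivial {i} {j} i≢j v (a , v≋a) (b , v≋b) with lastNonzero a
        ... | inj₂ a≈0 = λ p → trans (v≋a p) (sum-zero λ l → trans (*-congʳ (a≈0 l)) (zeroˡ (gen (C i) l p)))
        ... | inj₁ (l , al≉0 , _) = contradiction (C-injective C≈C) i≢j
          where
          a≈b : ∀ l → a l ≈ b l
          a≈b l = trans (sym (combination-unit (C i) a l))
            (trans (trans (sym (v≋a (unitPosition l))) (v≋b (unitPosition l))) (combination-unit (C j) b l))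
          C≈C : ∀ p → C i p ≈ C j p
          C≈C = A-determined a (C⊥ i) (C⊥ j) (λ a≈0 → al≉0 (a≈0 l)) λ p → begin
            A a p · C i p                        ≈⟨ combination-code (C i) a p ⟨
            combination (C i) a (codePosition p)  ≈⟨ v≋a (codePosition p) ⟨
            v (codePosition p)                    ≈⟨ v≋b (codePosition p) ⟩
            combination (C j) b (codePosition p)  ≈⟨ combination-code (C j) b p ⟩
            A b p · C j p                        ≈⟨ *-congʳ (A-cong a≈b p) ⟨
            A a p · C j p                        ∎

      module Translate (i : Fin m) (u : Vector Carrier n) (u∉S : ¬ Subspace.∣S∣ (𝓕 i) u) where

        x : Vector Carrier N
        x = C i

        u₀ : Vector Carrier k
        u₀ j = u (unitPosition j)

        -- Subtracting from `u` the vector of S with the same first `k` coordinates does not change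
        -- `u + S`; `w` and `w∞` are the coordinates that remain.
        w : Vector Carrier N
        w p = u (codePosition p) - A u₀ p · x p

        w∞ : Carrier
        w∞ = u lastPosition - H u₀ x

        nontrivial : ¬ ((∀ p → w p ≈ 0#) × w∞ ≈ 0#)
        nontrivial (w≈0 , w∞≈0) = u∉S (u₀ , position-elim (λ p → u p ≈ combination x u₀ p)
          (λ j → sym (combination-unit x u₀ j))
          (λ p → trans (x∙y⁻¹≈ε⇒x≈y _ _ (w≈0 p)) (sym (combination-code x u₀ p)))
          (trans (x∙y⁻¹≈ε⇒x≈y _ _ w∞≈0) (sym (combination-last x u₀))))

        -- A common point has coefficients `b` in the member `j`. Its first coordinates give
        -- `b = u₀ + a`, and the other two blocks then give the equations of `Meets`.
        meets : ∀ {j} → translate F u (𝓕 i) Unary.≬ Subspace.∣S∣ (𝓕 j) → ∃ (Meets x w w∞ (C j))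
        meets {j} (v , (v′ , (a , v′≋a) , v≋u+v′) , (b , v≋b)) = b
          , (λ p → begin
              w p ⊕ A b p · x p
                ≈⟨ +-congˡ (trans (*-congʳ (trans (A-cong b≈ p) (sum-+ u₀ a λ j → γ ^ (suc (toℕ p) * toℕ j))))
                     (distribʳ (x p) (A u₀ p) (A a p))) ⟩
              w p ⊕ (A u₀ p · x p ⊕ A a p · x p)
                ≈⟨ restore _ _ _ ⟩
              u (codePosition p) ⊕ A a p · x p
                ≈⟨ +-congˡ (trans (v′≋a (codePosition p)) (combination-code x a p)) ⟨
              u (codePosition p) ⊕ v′ (codePosition p)
                ≈⟨ v≋u+v′ (codePosition p) ⟨
              v (codePosition p)
                ≈⟨ trans (v≋b (codePosition p)) (combination-code (C j) b p) ⟩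
              A b p · C j p  ∎)
          , (begin
              w∞ ⊕ H b x
                ≈⟨ +-congˡ (trans (H-cong b≈ (λ p → refl)) (sum-+ u₀ a λ j → h F n k γ j x)) ⟩
              w∞ ⊕ (H u₀ x ⊕ H a x)
                ≈⟨ restore _ _ _ ⟩
              u lastPosition ⊕ H a x
                ≈⟨ +-congˡ (trans (v′≋a lastPosition) (combination-last x a)) ⟨
              u lastPosition ⊕ v′ lastPosition
                ≈⟨ v≋u+v′ lastPosition ⟨
              v lastPosition
                ≈⟨ trans (v≋b lastPosition) (combination-last (C j) b) ⟩
              H b (C j)  ∎)
          where
          restore : ∀ y z t → (y - z) ⊕ (z ⊕ t) ≈ y ⊕ t
          restore y z t = trans (sym (+-assoc (y - z) z t))
            (+-congʳ (trans (+-assoc y (- z) z) (trans (+-congˡ (-‿inverseˡ z)) (+-identityʳ y))))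
          b≈ : ∀ l → b l ≈ u₀ l ⊕ a l
          b≈ l = begin
            b l                                     ≈⟨ combination-unit (C j) b l ⟨
            combination (C j) b (unitPosition l)    ≈⟨ v≋b (unitPosition l) ⟨
            v (unitPosition l)                      ≈⟨ v≋u+v′ (unitPosition l) ⟩
            u₀ l ⊕ v′ (unitPosition l)              ≈⟨ +-congˡ (trans (v′≋a (unitPosition l)) (combination-unit x a l)) ⟩
            u₀ l ⊕ a l                              ∎

        coefficients : (J : Subset m) → (∀ {j} → j ∈ˢ J → translate F u (𝓕 i) Unary.≬ Subspace.∣S∣ (𝓕 j)) →
                       ∃ λ (b : Fin m → Vector Carrier k) → ∀ {j} → j ∈ˢ J → Meets x w w∞ (C j) (b j)
        coefficients J J-meets = chooseOn {R = λ j → Meets x w w∞ (C j)} (λ _ → 0#) J (meets ∘ J-meets)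

  -- The case k = 2: counting slopes.

  module Plane {n : ℕ} (4<n : 4 < n) (n≤q : n ≤ q) {γ : Carrier} (γ-primitive : IsPrimitive F γ) where

    open Construction {1} {n} 4<n n≤q γ-primitive
    open Dual {N} (λ p → γ ^ toℕ p) (powers-injective γ-primitive N<q) 1

    module Slopes {m : ℕ} {x w : Vector Carrier N} {w∞ : Carrier} (x⊥ : Orthogonal x)
      (nontrivial : ¬ ((∀ p → w p ≈ 0#) × w∞ ≈ 0#))
      (C : Fin m → Vector Carrier N) (C⊥ : ∀ i → Orthogonal (C i))
      (C-injective : ∀ {i j} → (∀ p → C i p ≈ C j p) → i ≡ j)
      (b : Fin m → Vector Carrier 2) (J : Subset m) (meets : ∀ {j} → j ∈ˢ J → Meets x w w∞ (C j) (b j)) where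

      open Meeting {m} {x} {w} {w∞} x⊥ nontrivial C C⊥ C-injective b J meets

      -- For `k = 2`, `A b p` is `b zero ⊕ b (suc zero) · y p`; these nodes are the nodes of the
      -- code multiplied by `γ`.
      y : Vector Carrier N
      y p = γ ^ suc (toℕ p)

      y-injective : ∀ {p p′} → y p ≈ y p′ → p ≡ p′
      y-injective eq = powers-injective γ-primitive N<q (·-cancelˡ (proj₁ γ-primitive) eq)

      direction : Carrier → Carrier → Vector Carrier 2
      direction a a′ zero    = a
      direction a a′ (suc _) = a′

      -- If `w` vanished, `A (b j)` would take `x` and `C j` to the same word, making the two
      -- codewords equal.
      w≉0 : ∀ {j} → j ∈ˢ J → ¬ (∀ p → w p ≈ 0#)
      w≉0 {j} j∈J w≈0 = C≉x j∈J λ p → sym (A-determined (b j) x⊥ (C⊥ j) (b≉0 j∈J)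
        (λ p → trans (sym (trans (+-congʳ (w≈0 p)) (+-identityˡ _))) (proj₁ (meets j∈J) p)) p)

      infinite-bound : ∀ I → I ⊆ J → (∀ {j} → j ∈ˢ I → b j (suc zero) ≈ 0#) → ∣ I ∣ ≤ 2 * N + 1
      infinite-bound I I⊆J b₁≈0 = Line.line-bound I I⊆J (direction 1# 0#) (λ j → b j zero) λ
        { {j} j∈I zero       → sym (*-identityʳ (b j zero))
        ; {j} j∈I (suc zero) → trans (b₁≈0 j∈I) (sym (zeroʳ (b j zero))) }

      -- The slope of each member is a root of `numerator y w`, of degree at most `N`; members
      -- sharing a slope have coefficients on one line, where `line-bound` allows `2 N + 1`.
      finite-bound : ∀ I → I ⊆ J → (∀ {j} → j ∈ˢ I → ¬ b j (suc zero) ≈ 0#) → ∣ I ∣ ≤ N * (2 * N + 1)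
      finite-bound I I⊆J b₁≉0 with nonempty? I
      ... | no  empty = ℕₚ.≤-trans (∣J∣≤0 λ j∈I → empty (_ , j∈I)) z≤n
      ... | yes (o , o∈I) with lastNonzero w
      ...   | inj₂ w≈0 = contradiction w≈0 (w≉0 (I⊆J o∈I))
      ...   | inj₁ (t , wt≉0 , _) =
        let d , _ , d≤N , a≉0 , poly = nonzero-leading (proj₂ (numerator-polynomial y w))
                                                       (numerator-nonzero y w y-injective t wt≉0)
        in ℕₚ.≤-trans (roots-fibred (2 * N + 1) poly a≉0 σ I root fibre) (ℕₚ.*-monoˡ-≤ (2 * N + 1) d≤N)
        where
        slopes : ∃ λ (σ : Fin m → Carrier) → ∀ {j} → j ∈ˢ I → b j zero ≈ b j (suc zero) · σ j
        slopes = chooseOn {R = λ j σ → b j zero ≈ b j (suc zero) · σ} 0# I λ {j} j∈I →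
          let z , z·b≈1 = inverse (b₁≉0 j∈I) in z · b j zero , (begin
            b j zero                            ≈⟨ *-identityˡ _ ⟨
            1# · b j zero                       ≈⟨ *-congʳ (trans (*-comm _ z) z·b≈1) ⟨
            b j (suc zero) · z · b j zero       ≈⟨ *-assoc _ z _ ⟩
            b j (suc zero) · (z · b j zero)     ∎)
        σ : Fin m → Carrier
        σ = proj₁ slopes
        fibre : ∀ r (I′ : Subset m) → I′ ⊆ I → (∀ {i} → i ∈ˢ I′ → σ i ≈ r) → ∣ I′ ∣ ≤ 2 * N + 1
        fibre r I′ I′⊆I σ≈r = Line.line-bound I′ (I⊆J ∘ I′⊆I) (direction r 1#) (λ j → b j (suc zero)) λ
          { j∈I′ zero           → trans (proj₂ slopes (I′⊆I j∈I′)) (*-congˡ (σ≈r j∈I′))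
          ; {j} j∈I′ (suc zero) → sym (*-identityʳ (b j (suc zero))) }
        root : ∀ {j} → j ∈ˢ I → numerator y w (σ j) ≈ 0#
        root {j} j∈I = begin
          numerator y w (σ j)                                    ≈⟨ numerator-sum y w Δ (σ j) (b j (suc zero)) w≈ ⟩
          b j (suc zero) · productOf y (σ j) · sum Δ             ≈⟨ *-congˡ ΣΔ≈0 ⟩
          b j (suc zero) · productOf y (σ j) · 0#                ≈⟨ zeroʳ _ ⟩
          0#                                                     ∎
          where
          -- The difference `C j - x`, in the form to which `orthogonal-combine` applies; its
          -- entries sum to zero by the single parity check, `s = 0`.
          Δ : Vector Carrier N
          Δ p = 1# · C j p ⊕ (- 1#) · x p
          ΣΔ≈0 : sum Δ ≈ 0#
          ΣΔ≈0 = trans (sum-cong-≋ λ p → sym (*-identityˡ (Δ p)))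
                       (orthogonal-combine 1# (- 1#) (C⊥ j) x⊥ 0 (s≤s z≤n))
          A≈ : ∀ p → A (b j) p ≈ b j (suc zero) · (y p ⊕ σ j · 1#)
          A≈ p = begin
            b j zero · γ ^ (suc (toℕ p) * 0) ⊕ (b j (suc zero) · γ ^ (suc (toℕ p) * 1) ⊕ 0#)
              ≈⟨ +-cong (*-cong (proj₂ slopes j∈I) (^-congʳ γ (ℕₚ.*-zeroʳ (suc (toℕ p)))))
                        (trans (+-identityʳ _) (*-congˡ (^-congʳ γ (ℕₚ.*-identityʳ (suc (toℕ p)))))) ⟩
            b j (suc zero) · σ j · 1# ⊕ b j (suc zero) · y p
              ≈⟨ trans (+-comm _ _) (trans (+-congˡ (*-assoc _ _ _)) (sym (distribˡ _ _ _))) ⟩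
            b j (suc zero) · (y p ⊕ σ j · 1#)  ∎
          w≈ : ∀ p → w p ≈ b j (suc zero) · ((y p ⊕ σ j · 1#) · Δ p)
          w≈ p = trans (∙-cancelʳ (A (b j) p · x p) (w p) _ (begin
            w p ⊕ A (b j) p · x p                     ≈⟨ proj₁ (meets (I⊆J j∈I)) p ⟩
            A (b j) p · C j p                         ≈⟨ *-congˡ Δ⊕x ⟨
            A (b j) p · (Δ p ⊕ x p)                   ≈⟨ distribˡ _ _ _ ⟩
            A (b j) p · Δ p ⊕ A (b j) p · x p         ∎))
            (trans (*-congʳ (A≈ p)) (*-assoc _ _ _))
            where
            Δ⊕x : Δ p ⊕ x p ≈ C j p
            Δ⊕x = trans (+-congʳ (difference (C j p) (x p))) (trans (+-assoc _ _ _)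
              (trans (+-congˡ (-‿inverseˡ (x p))) (+-identityʳ (C j p))))

      bound : ∣ J ∣ ≤ 2 * N + 1 + N * (2 * N + 1)
      bound with split (λ j → b j (suc zero) ≈? 0#) J
      ... | J₁ , J₂ , eq , f₁ , f₂ = ℕₚ.≤-trans (ℕₚ.≤-reflexive eq) (ℕₚ.+-mono-≤
        (infinite-bound J₁ (proj₁ ∘ f₁) (proj₂ ∘ f₁)) (finite-bound J₂ (proj₁ ∘ f₂) (proj₂ ∘ f₂)))

    isAAD : (enum : CodewordEnumeration F n 2 γ) →
            IsAAD F n 2 (1 + 2 * (n ∸ 2) * (2 * n ∸ 5)) (family F n 2 γ 4<n enum)
    isAAD enum = record { isPartialSpread = isPartialSpread ; atMost = atMost }
      where
      open Family enum
      atMost : ∀ i u → ¬ Subspace.∣S∣ (𝓕 i) u → ∀ (J : Subset m) →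
        (∀ {j} → j ∈ˢ J → translate F u (𝓕 i) Unary.≬ Subspace.∣S∣ (𝓕 j)) → ∣ J ∣ ≤ 1 + 2 * (n ∸ 2) * (2 * n ∸ 5)
      atMost i u u∉S J J-meets = ℕₚ.≤-trans (Slopes.bound (C⊥ i) nontrivial C C⊥ C-injective
        (proj₁ (coefficients J J-meets)) J (proj₂ (coefficients J J-meets))) (slope-bound 4<n)
        where open Translate i u u∉S

  -- The case k = 1: a single line.

  module Point {n : ℕ} (2<n : 2 < n) (n≤q : n ≤ q) {γ : Carrier} (γ-primitive : IsPrimitive F γ) where

    open Construction {0} {n} 2<n n≤q γ-primitive

    isAAD : (enum : CodewordEnumeration F n 1 γ) → IsAAD F n 1 (n ∸ 1) (family F n 1 γ 2<n enum)
    isAAD enum = record { isPartialSpread = isPartialSpread ; atMost = atMost }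
      where
      open Family enum
      atMost : ∀ i u → ¬ Subspace.∣S∣ (𝓕 i) u → ∀ (J : Subset m) →
        (∀ {j} → j ∈ˢ J → translate F u (𝓕 i) Unary.≬ Subspace.∣S∣ (𝓕 j)) → ∣ J ∣ ≤ n ∸ 1
      -- Coefficient vectors of length 1 all lie on the line through the constant `1#`, so one use
      -- of `line-bound` covers `J`, with `N + 1 = n - 1`.
      atMost i u u∉S J J-meets = ℕₚ.≤-trans
        (Meeting.Line.line-bound (C⊥ i) nontrivial C C⊥ C-injective (proj₁ (coefficients J J-meets)) J
          (proj₂ (coefficients J J-meets)) J (λ j∈J → j∈J) (λ _ → 1#)
          (λ j → proj₁ (coefficients J J-meets) j zero) λ { _ zero → sym (*-identityʳ _) })
        (ℕₚ.≤-reflexive (≡.trans (≡.cong (_+ 1) (ℕₚ.+-identityʳ N)) (ℕₚ.m∸n+n≡m (ℕₚ.m<n⇒0<n∸m {1} {n} (ℕₚ.<⇒≤ 2<n)))))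
        where open Translate i u u∉S

theorem3 : ∀ {c ℓ : Level} (n k q : ℕ) → 0 < n → 0 < k → (2k<n : 2 * k < n) →
    IsPrimePower q → n * k ≤ q →
    (F : FiniteField c ℓ q) (γ : FiniteField.Carrier F) → IsPrimitive F γ →
    (enum : CodewordEnumeration F n k γ) →
    IsPartialSpread F n k (family F n k γ 2k<n enum)
    × (k ≡ 1 → IsAAD F n k (n ∸ 1) (family F n k γ 2k<n enum))
    × (k ≡ 2 → IsAAD F n k (1 + 2 * (n ∸ 2) * (2 * n ∸ 5)) (family F n k γ 2k<n enum))
theorem3 n (suc k′) q 0<n 0<k 2k<n _ nk≤q F γ γ-primitive enum =
    Field.Construction.Family.isPartialSpread F 2k<n n≤q γ-primitive enum
  , (λ { ≡.refl → Field.Point.isAAD F 2k<n n≤q γ-primitive enum })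
  , (λ { ≡.refl → Field.Plane.isAAD F 2k<n n≤q γ-primitive enum })
  where
  n≤q : n ≤ q
  n≤q = ℕₚ.≤-trans (ℕₚ.m≤m*n n (suc k′)) nk≤q
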